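{- An oriented graph $D$ is a global K-graph if and only if it is a local K-graph.
   Context: **Digraphs.** A digraph is an irreflexive binary relation $D$ on a finite nonempty set, the set of vertices of $D$. The ordered pairs in $D$ are its edges; an edge $(a,b)$ begins in $a$ and ends in $b$. An oriented graph is an antisymmetric digraph (if $(a,b)\in D$ then $(b,a)\notin D$). A W-vertex of $D$ is a vertex in which no edge ends; an E-vertex is a vertex in which no edge begins; an inner vertex is one that is neither. A W-edge is an edge beginning in a W-vertex; an E-edge is an edge ending in an E-vertex. A W-edge $(a,b)$ is functional when $(a,c)\in D$ implies $c=b$; an E-edge $(b,a)$ is functional when $(c,a)\in D$ implies $c=b$. Digraphs are disjoint when their vertex sets are disjoint. **Semipaths.** For $n\ge 1$ consider a sequence $a_1,\dots,a_n$ of vertices such that for every $i\in\{1,\dots,n-1\}$ we have $(a_i,a_{i+1})\in D$ or $(a_{i+1},a_i)\in D$. It is a semipath when all its vertices are mutually distinct (joining $a_1$ to $a_n$); it is a semicycle when $a_1=a_n$, $n\ge 4$, and $a_1,\dots,a_{n-1}$ are mutually distinct. A path is a semipath with $(a_i,a_{i+1})\in D$ for every $i\in\{1,\dots,n-1\}$. $D$ is weakly connected when every two vertices are joined by a semipath; asemicyclic when it has no semicycles; W-E-functional when all its W-edges and E-edges are functional. **Basic K-graphs.** A basic K-graph $B$ is an oriented graph with vertices $a_1,\dots,a_{k_W},b,c_1,\dots,c_{k_E}$ (all distinct, $k_W,k_E\ge 1$) and edges exactly $(a_i,b)$ for $1\le i\le k_W$ and $(b,c_j)$ for $1\le j\le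 k_E$, together with distinguished W-edges $NW(B),SW(B)$ and distinguished E-edges $NE(B),SE(B)$, such that for each $X\in\{W,E\}$: if $k_X\ge 2$, then $NX(B)\ne SX(B)$. **Cut.** Let $D_W,D_E$ be disjoint oriented graphs, $e_W=(a,b)$ a functional E-edge of $D_W$ and $e_E=(c,d)$ a functional W-edge of $D_E$. With $e=(a,d)$, $D_W[e_W-e_E]D_E$ is the oriented graph $(D_W-\{e_W\})\cup(D_E-\{e_E\})\cup\{e\}$ on the union of the vertices of $D_W$ and $D_E$ with $b$ and $c$ omitted. **Constructions.** A construction $G$ is a finite binary tree with an oriented graph and distinguished edges at each node; the graph at the root is the root graph of $G$, and its distinguished edges at the root are denoted $YX(G)$, $Y\in\{N,S\}$, $X\in\{W,E\}$. Constructions are defined inductively: (1) a single-node tree whose node carries a basic K-graph $B$ with its distinguished edges is a construction; (2) if $G_W,G_E$ are constructions with disjoint root graphs $D_W,D_E$, $e_W$ is a functional E-edge of $D_W$ and $e_E$ is a functional W-edge of $D_E$, and for every $Y\in\{N,S\}$ we have $e_W=YE(G_W)$ or $e_E=YW(G_E)$, then $G=G_W[e_W-e_E]G_E$ is a construction: its tree has a new root whose successors are the roots of $G_W$ and $G_E$, its root graph is $D_W[e_W-e_E]D_E$, and for $Y\in\{N,S\}$, $YW(G)=YW(G_W)$ if $e_E=YW(G_E)$ and $YW(G)=YW(G_E)$ otherwise; $YE(G)=YE(G_E)$ if $e_W=YE(G_W)$ and $YE(G)=YE(G_W)$ otherwise. The other nodes keep their data from $G_W$ and $G_E$. A global K-graph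 is an oriented graph that is the root graph of a construction. **Local K-graphs.** For a digraph $D$ let $\mathcal{L}$ be a set of four functions $NW,SW,NE,SE$ on the inner vertices of $D$ such that, for $Y\in\{N,S\}$ and every inner vertex $a$, $YW(a)$ is an edge of $D$ of the form $(b,a)$ and $YE(a)$ is an edge of $D$ of the form $(a,b)$. For an inner vertex $a$ let $k^a_W$ be the number of edges ending in $a$ and $k^a_E$ the number of edges beginning in $a$. $\langle D,\mathcal{L}\rangle$ separates $N$ from $S$ when for every inner vertex $a$ and every $X\in\{W,E\}$: if $k^a_X\ge 2$ then $NX(a)\ne SX(a)$. A path $a_1,\dots,a_n$ of $D$ is $Y$-decent in $\langle D,\mathcal{L}\rangle$ when $n=1$, or $n\ge 2$ and [$YE(a_1)=(a_1,a_2)$ or $YW(a_n)=(a_{n-1},a_n)$] (an equality involving a function at a vertex that is not inner counts as false); it is decent when it is both $N$-decent and $S$-decent. For an oriented graph $D$, $\langle D,\mathcal{L}\rangle$ is a local compass graph when $D$ is weakly connected, asemicyclic, W-E-functional and has an inner vertex, $\langle D,\mathcal{L}\rangle$ separates $N$ from $S$, and every path of $D$ all of whose vertices are inner is decent in $\langle D,\mathcal{L}\rangle$. An oriented graph $D$ is a local K-graph when $\langle D,\mathcal{L}\rangle$ is a local compass graph for some $\mathcal{L}$. -}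

module Defs where

open import Level using (Level) renaming (suc to lsuc)
open import Data.Nat.Base using (ℕ; _≤_)
open import Data.Bool.Base using (if_then_else_)
open import Data.Maybe.Base using (just)
open import Data.Product.Base using (∃; ∃-syntax; ∃₂; _×_; _,_; proj₁; proj₂)
open import Data.Product.Properties using (≡-dec)
open import Data.Sum.Base using (_⊎_)
open import Data.List.Base
  using (List; []; _∷_; _++_; _∷ʳ_; length; filter; head; last)
open import Data.List.Membership.Propositional using (_∈_; _∉_)
open import Data.List.Relation.Unary.All using (All)
open import Data.List.Relation.Unary.Linked using (Linked)
open import Data.List.Relation.Unary.Unique.Propositional using (Unique)
open import Data.List.Relation.Binary.Disjoint.Propositional using (Disjoint)
open import Function.Bundles using (_⇔_)
open import Relation.Binary.Definitions using (DecidableEquality)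
open import Relation.Binary.PropositionalEquality.Core using (_≡_; _≢_)
open import Relation.Nullary.Decidable.Core using (does)
open import Relation.Nullary.Negation.Core using (¬_)

-- The ambient supply of vertices.  Constructions glue graphs with disjoint
-- vertex sets and drop vertices, so new vertices must always be available:
-- the supply is infinite, in the sense that no finite list exhausts it.
-- Any type A with decidable equality embeds in such a supply, e.g. A ⊎ ℕ.
record VertexUniverse (ℓ : Level) : Set (lsuc ℓ) where
  field
    Vertex : Set ℓ
    _≟_    : DecidableEquality Vertex
    fresh  : (xs : List Vertex) → ∃[ x ] x ∉ xs

data Pole : Set where
  N S : Pole

data Side : Set where
  W E : Side

module KGraphs {ℓ : Level} (𝒰 : VertexUniverse ℓ) where
  open VertexUniverse 𝒰 public

  Edge : Set ℓ
  Edge = Vertex × Vertex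

  _≟ᵉ_ : DecidableEquality Edge
  _≟ᵉ_ = ≡-dec _≟_ _≟_

  -- A finite set is a list without repetitions, used only through membership
  -- and (for sets of edges) through the number of its elements.
  record Digraph : Set ℓ where
    field
      vertices        : List Vertex
      edges           : List Edge
      vertices-unique : Unique vertices
      edges-unique    : Unique edges
      nonempty        : ∃[ a ] a ∈ vertices
      endpoints       : ∀ {a b} → (a , b) ∈ edges → a ∈ vertices × b ∈ vertices
      irreflexive     : ∀ {a} → (a , a) ∉ edges

  open Digraph public

  record OrientedGraph : Set ℓ where
    field
      digraph       : Digraph
      antisymmetric : ∀ {a b} → (a , b) ∈ edges digraph → (b , a) ∉ edges digraph

  open OrientedGraph public

  module _ (D : Digraph) where

    IsWVertex : Vertex → Set ℓ
    IsWVertex a = a ∈ vertices D × (∀ x → (x , a) ∉ edges D)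

    IsEVertex : Vertex → Set ℓ
    IsEVertex a = a ∈ vertices D × (∀ x → (a , x) ∉ edges D)

    IsInner : Vertex → Set ℓ
    IsInner a = a ∈ vertices D × ¬ IsWVertex a × ¬ IsEVertex a

    IsWEdge : Edge → Set ℓ
    IsWEdge e = e ∈ edges D × IsWVertex (proj₁ e)

    IsEEdge : Edge → Set ℓ
    IsEEdge e = e ∈ edges D × IsEVertex (proj₂ e)

    IsFunctionalWEdge : Edge → Set ℓ
    IsFunctionalWEdge e =
      IsWEdge e × (∀ c → (proj₁ e , c) ∈ edges D → c ≡ proj₂ e)

    IsFunctionalEEdge : Edge → Set ℓ
    IsFunctionalEEdge e =
      IsEEdge e × (∀ c → (c , proj₂ e) ∈ edges D → c ≡ proj₁ e)

    Adjacent : Vertex → Vertex → Set ℓ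
    Adjacent a b = (a , b) ∈ edges D ⊎ (b , a) ∈ edges D

    -- The sequences a₁,…,aₙ (n ≥ 1) underlying semipaths and semicycles.
    IsChain : List Vertex → Set ℓ
    IsChain xs =
      1 ≤ length xs × All (_∈ vertices D) xs × Linked Adjacent xs

    IsSemipath : List Vertex → Set ℓ
    IsSemipath xs = IsChain xs × Unique xs

    -- For xs = a ∷ zs ∷ʳ a, the terms a₁,…,aₙ₋₁ are a ∷ zs.
    IsSemicycle : List Vertex → Set ℓ
    IsSemicycle xs =
      IsChain xs × 4 ≤ length xs ×
      (∃₂ λ a zs → xs ≡ a ∷ zs ∷ʳ a × Unique (a ∷ zs))

    IsPath : List Vertex → Set ℓ
    IsPath xs = IsSemipath xs × Linked (λ a b → (a , b) ∈ edges D) xs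

    IsWeaklyConnected : Set ℓ
    IsWeaklyConnected = ∀ a b → a ∈ vertices D → b ∈ vertices D →
      ∃[ xs ] IsSemipath xs × head xs ≡ just a × last xs ≡ just b

    IsAsemicyclic : Set ℓ
    IsAsemicyclic = ∀ xs → ¬ IsSemicycle xs

    IsWEFunctional : Set ℓ
    IsWEFunctional =
      (∀ e → IsWEdge e → IsFunctionalWEdge e) ×
      (∀ e → IsEEdge e → IsFunctionalEEdge e)

    -- degree W a and degree E a are the numbers of edges ending in a and
    -- beginning in a.
    degree : Side → Vertex → ℕ
    degree W a = length (filter (λ e → proj₂ e ≟ a) (edges D))
    degree E a = length (filter (λ e → proj₁ e ≟ a) (edges D))

  -- κ Y X is the distinguished edge YX.
  Compass : Set ℓ
  Compass = Pole → Side → Edge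

  record IsBasicKGraph (B : OrientedGraph) (κ : Compass) : Set ℓ where
    field
      as : List Vertex
      b  : Vertex
      cs : List Vertex
      1≤kW       : 1 ≤ length as
      1≤kE       : 1 ≤ length cs
      distinct   : Unique (as ++ b ∷ cs)
      vertices-B : ∀ v → v ∈ vertices (digraph B) ⇔ v ∈ as ++ b ∷ cs
      edges-B    : ∀ x y → (x , y) ∈ edges (digraph B) ⇔
                     ((x ∈ as × y ≡ b) ⊎ (x ≡ b × y ∈ cs))
      W-edges    : ∀ Y → IsWEdge (digraph B) (κ Y W)
      E-edges    : ∀ Y → IsEEdge (digraph B) (κ Y E)
      separateW  : 2 ≤ length as → κ N W ≢ κ S W
      separateE  : 2 ≤ length cs → κ N E ≢ κ S E

  -- IsCut DW eW DE eE D says that D is DW[eW - eE]DE, for eW = (a , b) and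
  -- eE = (c , d).  This determines D up to the order of its lists, so that
  -- every listing of the cut graph is admitted.
  record IsCut (DW : OrientedGraph) (eW : Edge)
               (DE : OrientedGraph) (eE : Edge)
               (D : OrientedGraph) : Set ℓ where
    field
      vertices-cut : ∀ v → v ∈ vertices (digraph D) ⇔
        ((v ∈ vertices (digraph DW) ⊎ v ∈ vertices (digraph DE)) ×
         v ≢ proj₂ eW × v ≢ proj₁ eE)
      edges-cut : ∀ e → e ∈ edges (digraph D) ⇔
        ((e ∈ edges (digraph DW) × e ≢ eW) ⊎
         (e ∈ edges (digraph DE) × e ≢ eE) ⊎
         e ≡ (proj₁ eW , proj₂ eE))

  cutCompass : Compass → Edge → Compass → Edge → Compass
  cutCompass κW eW κE eE Y W =
    if does (eE ≟ᵉ κE Y W) then κW Y W else κE Y W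
  cutCompass κW eW κE eE Y E =
    if does (eW ≟ᵉ κW Y E) then κE Y E else κW Y E

  -- Construction D κ is the type of constructions with root graph D and
  -- distinguished edges κ at the root; the binary tree is the derivation.
  data Construction : OrientedGraph → Compass → Set ℓ where
    basic : ∀ {B κ} → IsBasicKGraph B κ → Construction B κ
    cut   : ∀ {DW DE D κW κE eW eE} →
            Construction DW κW →
            Construction DE κE →
            Disjoint (vertices (digraph DW)) (vertices (digraph DE)) →
            IsFunctionalEEdge (digraph DW) eW →
            IsFunctionalWEdge (digraph DE) eE →
            (∀ Y → eW ≡ κW Y E ⊎ eE ≡ κE Y W) →
            IsCut DW eW DE eE D →
            Construction D (cutCompass κW eW κE eE)

  IsGlobalKGraph : OrientedGraph → Set ℓ
  IsGlobalKGraph D = ∃[ κ ] Construction D κ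

  -- The functions NW, SW, NE, SE on inner vertices are given by functions on
  -- all of Vertex; their values elsewhere are never used.
  LocalCompass : Set ℓ
  LocalCompass = Pole → Side → Vertex → Edge

  module _ (D : Digraph) (𝓛 : LocalCompass) where

    IsLocalCompass : Set ℓ
    IsLocalCompass = ∀ Y a → IsInner D a →
      (∃[ b ] 𝓛 Y W a ≡ (b , a) × (b , a) ∈ edges D) ×
      (∃[ b ] 𝓛 Y E a ≡ (a , b) × (a , b) ∈ edges D)

    Separates : Set ℓ
    Separates = ∀ a → IsInner D a → ∀ X →
      2 ≤ degree D X a → 𝓛 N X a ≢ 𝓛 S X a

    -- The second and third alternatives concern the first edge and the last
    -- edge of a sequence with at least two terms.
    IsDecentAt : Pole → List Vertex → Set ℓ
    IsDecentAt Y xs =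
      length xs ≡ 1 ⊎
      (∃[ x ] ∃[ y ] ∃[ zs ]
        xs ≡ x ∷ y ∷ zs × IsInner D x × 𝓛 Y E x ≡ (x , y)) ⊎
      (∃[ zs ] ∃[ x ] ∃[ y ]
        xs ≡ zs ++ x ∷ y ∷ [] × IsInner D y × 𝓛 Y W y ≡ (x , y))

    IsDecent : List Vertex → Set ℓ
    IsDecent xs = ∀ Y → IsDecentAt Y xs

  record IsLocalCompassGraph (D : OrientedGraph) (𝓛 : LocalCompass) : Set ℓ where
    field
      local-compass    : IsLocalCompass (digraph D) 𝓛
      weakly-connected : IsWeaklyConnected (digraph D)
      asemicyclic      : IsAsemicyclic (digraph D)
      WE-functional    : IsWEFunctional (digraph D)
      has-inner        : ∃[ a ] IsInner (digraph D) a
      separates        : Separates (digraph D) 𝓛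
      paths-decent     : ∀ xs → IsPath (digraph D) xs →
                         All (IsInner (digraph D)) xs →
                         IsDecent (digraph D) 𝓛 xs

  IsLocalKGraph : OrientedGraph → Set ℓ
  IsLocalKGraph D = ∃[ 𝓛 ] IsLocalCompassGraph D 𝓛

{-# OPTIONS --safe #-}

-- A directed walk is recorded by its first and last edges.  Call an E-edge ε
-- good for Y when every walk from an inner vertex x to ε starts with YE(x), and
-- dually for W-edges.
-- Global to local: the distinguished edge YX of a construction is good for Y,
-- so if eW = YE or eE = YW then every walk across a cut is Y-decent.
-- Local to global: D may be cut at any edge e joining two inner vertices.  A
-- walk showing that eW is not good and one showing that eE is not good would
-- together form an indecent walk across e.  The good edges of a construction
-- are unique, since its edges YW and YE are joined by a walk; so the good one
-- among eW and eE is the distinguished edge, and the pieces may be recombined.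
-- Connectedness and asemicyclicity are handled by two-colourings of the
-- vertices: a graph is connected when colourings constant on edges are
-- constant, and asemicyclic when every edge has a colouring constant on all the
-- other edges only.
module Submission where

open import Defs
open import Level using (Level)
open import Function.Base using (flip; _∘_; id)
open import Function.Bundles using (_⇔_; mk⇔; Equivalence)
open import Data.Bool.Base using (Bool; true; false; not; _∨_; if_then_else_)
open import Data.Bool.Properties using () renaming (_≟_ to _≟ᵇ_)
open import Data.Empty using (⊥; ⊥-elim)
open import Data.Maybe.Base using (just)
open import Data.Nat.Base using (_≤_; _<_; suc; z≤n; s≤s; s≤s⁻¹)
open import Data.Nat.Properties using (≤-refl; <-≤-trans)
open import Data.List.Base using (List; []; _∷_; _++_; _∷ʳ_; length; filter; head; last)
open import Data.List.Properties using (∷ʳ-injective; ++-assoc; filter-notAll)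
open import Data.List.Membership.Propositional using (_∈_; _∉_; find; lose)
open import Data.List.Membership.Propositional.Properties
  using (∈-filter⁺; ∈-filter⁻; ∈-++⁺ʳ; ∈-++⁺ˡ; ∈-++⁻)
import Data.List.Membership.DecPropositional as DecMembership
open import Data.List.Relation.Unary.Any using (Any; here; there; any?)
open import Data.List.Relation.Unary.All using (All; []; _∷_)
import Data.List.Relation.Unary.All as All
open import Data.List.Relation.Unary.All.Properties using (¬Any⇒All¬; ∷ʳ⁺)
open import Data.List.Relation.Unary.AllPairs using ([]; _∷_)
open import Data.List.Relation.Unary.Linked using (Linked; [-]; _∷_)
import Data.List.Relation.Unary.Linked as Linked
open import Data.List.Relation.Unary.Unique.Propositional using (Unique)
import Data.List.Relation.Unary.Unique.Propositional.Properties as Unique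
open import Data.List.Relation.Binary.Disjoint.Propositional using (Disjoint)
open import Data.Product.Base using (∃; ∃-syntax; ∃₂; _×_; _,_; proj₁; proj₂; swap)
open import Data.Product.Properties using (,-injective)
open import Data.Sum.Base as Sum using (_⊎_; inj₁; inj₂; [_,_]′)
open import Relation.Binary.Definitions using (DecidableEquality)
open import Relation.Binary.Construct.Closure.ReflexiveTransitive as Star using (Star; ε; _◅_; _◅◅_)
open import Relation.Binary.PropositionalEquality
  using (_≡_; _≢_; refl; sym; trans; cong; cong₂; subst; subst₂; ≢-sym)
open import Relation.Nullary using (¬_; Dec; yes; no; does; ¬?)
open import Relation.Nullary.Decidable using (map′; _×-dec_)

-- The obstacle is that a cut graph contains neither of the two edges cut, so walks of the pieces
-- are not walks of the cut graph. It is therefore treated as a union of two images: the W piece is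
-- embedded by sending b to d, the E piece by sending c to a, and the images overlap in the single
-- edge (a , d), which is the image of both cut edges. A walk across the cut is then a walk ending
-- in (a , b) continued by a walk beginning with (c , d), which is why walks are indexed by their
-- end edges. Most facts are proved on the E side only; reversing all edges turns a cut into a cut
-- with the pieces exchanged and gives the W side. From local to global, an induction that yields
-- only a construction is too weak: its distinguished edges must be tied to the compass of the given
-- graph. Goodness quantifies over all walks, so instead of deciding it, the induction provides for
-- every E-edge other than the distinguished one an explicit walk refuting its goodness, and dually
-- for W-edges.

module Relational {ℓ : Level} {A : Set ℓ} where

  private variable
    R R′ : A → A → Set ℓ
    V : A → Set ℓ
    nE nW : Pole → A → A
    x y z u v w p q : A
    Y : Pole

  -- Walks, bridges and compass graphs for an arbitrary relation.

  HasIn HasOut Inner : (A → A → Set ℓ) → A → Set ℓ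
  HasIn  R x = ∃[ u ] R u x
  HasOut R x = ∃[ u ] R x u
  Inner  R x = HasIn R x × HasOut R x

  -- Walk R x y z w is a directed walk with first edge (x , y) and last edge
  -- (z , w); its vertices other than x and w are inner.
  data Walk (R : A → A → Set ℓ) : A → A → A → A → Set ℓ where
    one : R x y → Walk R x y x y
    _◂_ : R x y → Walk R y z u v → Walk R x y u v

  infixr 5 _◂_

  first : Walk R x y u v → R x y
  first (one r) = r
  first (r ◂ _) = r

  final : Walk R x y u v → R u v
  final (one r) = r
  final (_ ◂ t) = final t

  -- The overlap is a whole edge rather than a vertex, because the images of two pieces of a cut
  -- overlap in the new edge.
  _⊙_ : Walk R x y u v → Walk R u v p q → Walk R x y p q
  one _   ⊙ t = t
  (r ◂ s) ⊙ t = r ◂ (s ⊙ t)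

  _▻_ : Walk R x y u v → R v w → Walk R x y v w
  one r   ▻ t = r ◂ one t
  (r ◂ s) ▻ t = r ◂ (s ▻ t)

  reverse : Walk R x y u v → Walk (flip R) v u y x
  reverse (one r) = one r
  reverse (r ◂ s) = reverse s ▻ r

  map : (π : A → A) → (∀ {x y} → R x y → R′ (π x) (π y)) →
        Walk R x y u v → Walk R′ (π x) (π y) (π u) (π v)
  map π h (one r) = one (h r)
  map π h (r ◂ s) = h r ◂ map π h s

  -- The conditions on the compass concerning E; those concerning W are the
  -- same conditions for the opposite graph.
  record Half (R : A → A → Set ℓ) (n : Pole → A → A) : Set ℓ where
    field
      points     : ∀ Y {x} → Inner R x → R x (n Y x)
      functional : ∀ {x x′ y} → R x y → R x′ y → x′ ≡ x ⊎ HasOut R y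
      separates  : ∀ {x y} → Inner R x → n N x ≡ n S x → R x y → y ≡ n N x

  -- Intermediate vertices of a walk are inner automatically, and paths of one vertex need no
  -- condition. Repeated vertices are not forbidden here; when every edge is a bridge and there are
  -- no loops they cannot occur (`trace-unique`).
  Decent : (A → A → Set ℓ) → (nE nW : Pole → A → A) → Set ℓ
  Decent R nE nW = ∀ Y {x y z w} → Walk R x y z w → Inner R x → Inner R w →
    nE Y x ≡ y ⊎ nW Y w ≡ z

  record Bridge (R : A → A → Set ℓ) (x y : A) : Set ℓ where
    constructor bridge-by
    field
      colour   : A → Bool
      source   : colour x ≡ true
      target   : colour y ≡ false
      constant : ∀ {u v} → R u v → colour u ≡ colour v ⊎ (u ≡ x × v ≡ y)

  Connected : (A → A → Set ℓ) → (A → Set ℓ) → Set ℓ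
  Connected R V = (f : A → Bool) → (∀ {x y} → R x y → f x ≡ f y) →
    ∀ {x y} → V x → V y → f x ≡ f y

  record CompassGraph (R : A → A → Set ℓ) (V : A → Set ℓ)
                      (nE nW : Pole → A → A) : Set ℓ where
    field
      halfE     : Half R nE
      halfW     : Half (flip R) nW
      decent    : Decent R nE nW
      bridges   : ∀ {x y} → R x y → Bridge R x y
      connected : Connected R V
      has-inner : ∃[ x ] Inner R x

  bridge-flip : Bridge R x y → Bridge (flip R) y x
  bridge-flip {x = x} {y} (bridge-by f fx fy c) =
    bridge-by (not ∘ f) (cong not fy) (cong not fx) (λ r → go (c r))
    where
    go : f u ≡ f v ⊎ (u ≡ x × v ≡ y) → not (f v) ≡ not (f u) ⊎ (v ≡ y × u ≡ x)
    go (inj₁ e)       = inj₁ (cong not (sym e))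
    go (inj₂ (e , g)) = inj₂ (g , e)

  compassGraph-flip : CompassGraph R V nE nW → CompassGraph (flip R) V nW nE
  compassGraph-flip {R = R} {nE = nE} {nW} G = record
    { halfE     = halfW
    ; halfW     = halfE
    ; decent    = decent′
    ; bridges   = λ r → bridge-flip (bridges r)
    ; connected = λ f c → connected f (λ r → sym (c r))
    ; has-inner = proj₁ has-inner , swap (proj₂ has-inner)
    }
    where
    open CompassGraph G
    decent′ : Decent (flip R) nW nE
    decent′ Y t i j with decent Y (reverse t) (swap j) (swap i)
    ... | inj₁ e = inj₂ e
    ... | inj₂ e = inj₁ e

  Good : (A → A → Set ℓ) → (Pole → A → A) → Pole → A → A → Set ℓ
  Good R n Y p q = ∀ {x y} → Walk R x y p q → Inner R x → n Y x ≡ y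

  Bad : (A → A → Set ℓ) → (Pole → A → A) → Pole → A → A → Set ℓ
  Bad R n Y p q = ∃₂ λ x y → Walk R x y p q × Inner R x × n Y x ≢ y

  -- Badness is witnessed by one walk, so it can be pushed forward: `π` maps the walk, and if its
  -- image began with the distinguished edge, `ρ` would carry this equality back to the original
  -- walk.
  bad-map : (n : Pole → A → A) (Y : Pole) (π ρ : A → A) → (∀ {x y} → R′ x y → R (π x) (π y)) →
            (∀ {x y} → R′ x y → ρ (π y) ≡ y) →
            Bad R′ (λ Y x → ρ (n Y (π x))) Y p q → Bad R n Y (π p) (π q)
  bad-map n _ π ρ h retract (x , y , t , ((_ , r) , (_ , s)) , ne) =
    _ , _ , map π h t , ((_ , h r) , (_ , h s)) ,
    λ eq → ne (trans (cong ρ eq) (retract (first t)))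

  -- A positive form of: (p , q) is the only good E-edge.
  OnlyGood : (A → A → Set ℓ) → (Pole → A → A) → Pole → A → A → Set ℓ
  OnlyGood R n Y p q = ∀ {x y} → R x y → ¬ HasOut R y → (x ≡ p × y ≡ q) ⊎ Bad R n Y x y

  record Distinguished (R : A → A → Set ℓ) (n : Pole → A → A) (Y : Pole) (p q : A) : Set ℓ where
    field
      edge   : R p q
      no-out : ¬ HasOut R q
      good   : Good R n Y p q

  -- The colour `false` is never left when edges are followed forwards: other edges preserve
  -- colours, and the bridge itself leads to y, which is `false`.
  bridge-no-return : Bridge R x y → Walk R y z u v → v ≢ x
  bridge-no-return {R = R} {x} (bridge-by f fx fy c) t refl = bad (go t fy)
    where
    keep : R p q → f p ≡ false → f q ≡ false
    keep r e with c r
    ... | inj₁ g = trans (sym g) e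
    ... | inj₂ (refl , refl) = fy
    go : Walk R p q u v → f p ≡ false → f v ≡ false
    go (one r) e = keep r e
    go (r ◂ s) e = go s (keep r e)
    bad : f x ≡ false → ⊥
    bad e with trans (sym fx) e
    ... | ()

  -- Otherwise {x , y} would be a connected component without inner vertices.
  source-hasIn : DecidableEquality A → CompassGraph R V nE nW →
                 (∀ {x y} → R x y → V x × V y) → Dec (HasIn R x) →
                 R x y → ¬ HasOut R y → HasIn R x
  source-hasIn _≟_ G ends (yes i) r ¬o = i
  source-hasIn {R = R} {x = x} {y} _≟_ G ends (no ¬i) r ¬o =
    ⊥-elim (bad (connected f const (proj₁ (ends r)) (proj₁ (ends (proj₂ (proj₂ inn))))))
    where
    open CompassGraph G
    inn = proj₂ has-inner
    f : A → Bool
    f v = does (v ≟ x) ∨ does (v ≟ y)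
    const : ∀ {u v} → R u v → f u ≡ f v
    const {u} {v} s with u ≟ x | u ≟ y | v ≟ x | v ≟ y
    ... | _        | yes refl | _        | _        = ⊥-elim (¬o (_ , s))
    ... | _        | _        | yes refl | _        = ⊥-elim (¬i (_ , s))
    ... | yes _    | no _     | no _     | yes _    = refl
    ... | no _     | no _     | no _     | no _     = refl
    ... | yes refl | no _     | no _     | no v≢y with Half.functional halfW r s
    ...   | inj₁ eq = ⊥-elim (v≢y eq)
    ...   | inj₂ i  = ⊥-elim (¬i i)
    const {u} s | no u≢x | no _ | no _ | yes refl with Half.functional halfE r s
    ...   | inj₁ eq = ⊥-elim (u≢x eq)
    ...   | inj₂ o  = ⊥-elim (¬o o)
    fx : f x ≡ true
    fx with x ≟ x
    ... | yes _ = refl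
    ... | no ne = ⊥-elim (ne refl)
    bad : f x ≡ f (proj₁ has-inner) → ⊥
    bad eq with proj₁ has-inner ≟ x | proj₁ has-inner ≟ y | trans (sym fx) eq
    ... | yes refl | _        | _ = ¬i (proj₁ inn)
    ... | no _     | yes refl | _ = ¬o (proj₂ inn)
    ... | no _     | no _     | ()

open Relational

-- Cuts, and the embedding and collapse for one piece.

module Cutting {ℓ : Level} {A : Set ℓ} (_≟_ : DecidableEquality A) where

  -- The cut of (a , b) against (c , d), in a form that is self-dual.
  record Cut (R RW RE : A → A → Set ℓ) (V VW VE : A → Set ℓ) (a b c d : A) : Set ℓ where
    field
      VW?      : ∀ x → Dec (VW x)
      VE?      : ∀ x → Dec (VE x)
      disjoint : ∀ {x} → VW x → VE x → ⊥
      endsW    : ∀ {x y} → RW x y → VW x × VW y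
      endsE    : ∀ {x y} → RE x y → VE x × VE y
      eW       : RW a b
      eE       : RE c d
      no-out-b : ∀ {x} → ¬ RW b x
      no-in-c  : ∀ {x} → ¬ RE x c
      only-b   : ∀ {x} → RW x b → x ≡ a
      only-c   : ∀ {x} → RE c x → x ≡ d
      in-a     : HasIn RW a
      out-d    : HasOut RE d
      R⇒       : ∀ {x y} → R x y →
                 (RW x y × y ≢ b) ⊎ (RE x y × x ≢ c) ⊎ (x ≡ a × y ≡ d)
      W⇒R      : ∀ {x y} → RW x y → y ≢ b → R x y
      E⇒R      : ∀ {x y} → RE x y → x ≢ c → R x y
      e        : R a d
      V⇒       : ∀ {x} → V x → (VW x × x ≢ b) ⊎ (VE x × x ≢ c)
      W⇒V      : ∀ {x} → VW x → x ≢ b → V x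
      E⇒V      : ∀ {x} → VE x → x ≢ c → V x

  private variable
    R RW RE : A → A → Set ℓ
    V VW VE : A → Set ℓ
    a b c d : A

  cut-flip : Cut R RW RE V VW VE a b c d →
             Cut (flip R) (flip RE) (flip RW) V VE VW d c b a
  cut-flip C = record
    { VW? = VE? ; VE? = VW?
    ; disjoint = λ i j → disjoint j i
    ; endsW = λ r → swap (endsE r) ; endsE = λ r → swap (endsW r)
    ; eW = eE ; eE = eW
    ; no-out-b = no-in-c ; no-in-c = no-out-b
    ; only-b = only-c ; only-c = only-b
    ; in-a = out-d ; out-d = in-a
    ; R⇒ = λ r → R⇒′ (R⇒ r)
    ; W⇒R = E⇒R ; E⇒R = W⇒R
    ; e = e
    ; V⇒ = λ i → V⇒′ (V⇒ i)
    ; W⇒V = E⇒V ; E⇒V = W⇒V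
    }
    where
    open Cut C
    R⇒′ : ∀ {P Q T U : Set ℓ} → P ⊎ Q ⊎ (T × U) → Q ⊎ P ⊎ (U × T)
    R⇒′ (inj₁ i) = inj₂ (inj₁ i)
    R⇒′ (inj₂ (inj₁ i)) = inj₁ i
    R⇒′ (inj₂ (inj₂ (i , j))) = inj₂ (inj₂ (j , i))
    V⇒′ : ∀ {P Q : Set ℓ} → P ⊎ Q → Q ⊎ P
    V⇒′ (inj₁ i) = inj₂ i
    V⇒′ (inj₂ i) = inj₁ i

  -- π embeds the W piece into the cut graph, and ρ collapses the cut graph
  -- onto the W piece, sending the whole E piece to b.
  module Piece (C : Cut R RW RE V VW VE a b c d) where
    open Cut C
    private variable
      x y z : A

    π ρ : A → A
    π x = if does (x ≟ b) then d else x
    ρ x = if does (VW? x) then x else b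

    π-b : π b ≡ d
    π-b with b ≟ b
    ... | yes _ = refl
    ... | no ¬e = ⊥-elim (¬e refl)

    π-≢ : x ≢ b → π x ≡ x
    π-≢ {x} ¬e with x ≟ b
    ... | yes e = ⊥-elim (¬e e)
    ... | no _ = refl

    ρ-in : VW x → ρ x ≡ x
    ρ-in {x} i with VW? x
    ... | yes _ = refl
    ... | no ¬i = ⊥-elim (¬i i)

    ρ-out : ¬ VW x → ρ x ≡ b
    ρ-out {x} ¬i with VW? x
    ... | yes i = ⊥-elim (¬i i)
    ... | no _ = refl

    Va : VW a
    Va = proj₁ (endsW eW)

    ¬Vd : ¬ VW d
    ¬Vd i = disjoint i (proj₂ (endsE eE))

    out≢b : RW x y → x ≢ b
    out≢b r refl = no-out-b r

    π-source : RW x y → π x ≡ x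
    π-source r = π-≢ (out≢b r)

    hom : RW x y → R (π x) (π y)
    hom {x} {y} r with y ≟ b
    ... | no y≢b = subst (λ v → R v y) (sym (π-source r)) (W⇒R r y≢b)
    ... | yes refl with only-b r
    ...   | refl = subst (λ v → R v d) (sym (π-source r)) e

    retract : VW x → ρ (π x) ≡ x
    retract {x} i with x ≟ b
    ... | yes refl = ρ-out ¬Vd
    ... | no _ = ρ-in i

    π-injective : VW x → VW y → π x ≡ π y → x ≡ y
    π-injective i j eq = trans (sym (retract i)) (trans (cong ρ eq) (retract j))

    far : RE x y → ρ x ≡ ρ y
    far r = trans (ρ-out (λ i → disjoint i (proj₁ (endsE r))))
                  (sym (ρ-out (λ i → disjoint i (proj₂ (endsE r)))))

    collapse : R x y → RW (ρ x) (ρ y) ⊎ ρ x ≡ ρ y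
    collapse r with R⇒ r
    ... | inj₁ (s , _) =
      inj₁ (subst₂ RW (sym (ρ-in (proj₁ (endsW s)))) (sym (ρ-in (proj₂ (endsW s)))) s)
    ... | inj₂ (inj₁ (s , _)) = inj₂ (far s)
    ... | inj₂ (inj₂ (refl , refl)) =
      inj₁ (subst₂ RW (sym (ρ-in Va)) (sym (ρ-out ¬Vd)) eW)

    vertex : V d → VW x → V (π x)
    vertex {x} i j with x ≟ b
    ... | yes _ = i
    ... | no x≢b = W⇒V j x≢b

    -- The colouring is pulled back along the collapse `ρ`: the whole E piece takes the colour of b,
    -- so its edges cause no change of colour and the new edge behaves like (a , b).
    bridge : RW x y → Bridge RW x y → Bridge R (π x) (π y)
    bridge {x} {y} r (bridge-by f fx fy k) = bridge-by (f ∘ ρ)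
      (trans (cong f (retract (proj₁ (endsW r)))) fx)
      (trans (cong f (retract (proj₂ (endsW r)))) fy)
      go
      where
      go : ∀ {u v} → R u v → f (ρ u) ≡ f (ρ v) ⊎ (u ≡ π x × v ≡ π y)
      go s with R⇒ s
      ... | inj₂ (inj₁ (t , _)) = inj₁ (cong f (far t))
      ... | inj₁ (t , v≢b) rewrite ρ-in (proj₁ (endsW t)) | ρ-in (proj₂ (endsW t)) with k t
      ...   | inj₁ eq = inj₁ eq
      ...   | inj₂ (refl , refl) = inj₂ (sym (π-source t) , sym (π-≢ v≢b))
      go s | inj₂ (inj₂ (refl , refl)) rewrite ρ-in Va | ρ-out ¬Vd with k eW
      ...   | inj₁ eq = inj₁ eq
      ...   | inj₂ (refl , refl) = inj₂ (sym (π-source eW) , sym π-b)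

  -- The cut graph as the union of the images of its pieces.

  module Gluing (C : Cut R RW RE V VW VE a b c d) where
    open Cut C public
    module PW = Piece C
    module PE = Piece (cut-flip C)
    private variable
      x y z w x₁ y₁ : A
      nE nW nEW nEE nWW nWE : Pole → A → A

    -- Only b and c are moved by the embeddings, to d and to a, and the pieces are disjoint; hence
    -- the images can meet in the ends of the new edge only.
    shared : VW x → VE y → PW.π x ≡ PE.π y → (x ≡ a × y ≡ c) ⊎ (x ≡ b × y ≡ d)
    shared {x} {y} i j eq with x ≟ b | y ≟ c
    ... | yes _    | yes _    = ⊥-elim (PW.¬Vd (subst VW (sym eq) PW.Va))
    ... | yes x≡b  | no _     = inj₂ (x≡b , sym eq)
    ... | no _     | yes y≡c  = inj₁ (eq , y≡c)
    ... | no _     | no _     = ⊥-elim (disjoint i (subst VE (sym eq) j))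

    πa≡πc : PW.π a ≡ PE.π c
    πa≡πc = trans (PW.π-source eW) (sym PE.π-b)

    πb≡πd : PW.π b ≡ PE.π d
    πb≡πd = trans PW.π-b (sym (PE.π-source eE))

    LiftW LiftE : A → A → Set ℓ
    LiftW x y = ∃₂ λ x₁ y₁ → RW x₁ y₁ × PW.π x₁ ≡ x × PW.π y₁ ≡ y
    LiftE x y = ∃₂ λ x₁ y₁ → RE x₁ y₁ × PE.π x₁ ≡ x × PE.π y₁ ≡ y

    cover : R x y → LiftW x y ⊎ LiftE x y
    cover r with R⇒ r
    ... | inj₁ (s , y≢b) = inj₁ (_ , _ , s , PW.π-source s , PW.π-≢ y≢b)
    ... | inj₂ (inj₁ (s , x≢c)) = inj₂ (_ , _ , s , PE.π-≢ x≢c , PE.π-source s)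
    -- The new edge lifts to (a , b) and also to (c , d); either choice would do.
    ... | inj₂ (inj₂ (refl , refl)) = inj₁ (_ , _ , eW , PW.π-source eW , PW.π-b)

    V-d : V d
    V-d = E⇒V (proj₂ (endsE eE)) (PE.out≢b eE)

    -- The hypothesis excludes b, from whose image d the walk may go on in the E piece. An edge of
    -- the E piece leaving the image of any other x can only be (c , d), and that has the second
    -- lift (a , b).
    liftOutW : HasOut RW x → R (PW.π x) z → ∃[ y ] RW x y × PW.π y ≡ z
    liftOutW (_ , s) r with cover r
    ... | inj₁ (_ , _ , t , p , q)
      with PW.π-injective (proj₁ (endsW t)) (proj₁ (endsW s)) p
    ...   | refl = _ , t , q
    liftOutW (_ , s) r | inj₂ (_ , _ , t , p , q)
      with shared (proj₁ (endsW s)) (proj₁ (endsE t)) (sym p)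
    ...   | inj₂ (refl , _) = ⊥-elim (no-out-b s)
    ...   | inj₁ (refl , refl) with only-c t
    ...     | refl = _ , eW , trans πb≡πd q

    -- Here the hypothesis excludes c, whose image a may have further outgoing edges in the W piece.
    liftOutE : HasIn RE x → R (PE.π x) z → ∃[ y ] RE x y × PE.π y ≡ z
    liftOutE (_ , s) r with cover r
    ... | inj₂ (_ , _ , t , p , q)
      with PE.π-injective (proj₁ (endsE t)) (proj₂ (endsE s)) p
    ...   | refl = _ , t , q
    liftOutE (_ , s) r | inj₁ (_ , _ , t , p , q)
      with shared (proj₁ (endsW t)) (proj₂ (endsE s)) p
    ...   | inj₂ (refl , _) = ⊥-elim (no-out-b t)
    ...   | inj₁ (_ , refl) = ⊥-elim (no-in-c s)

    inner-homW : Inner RW x → Inner R (PW.π x)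
    inner-homW ((_ , r) , (_ , s)) = (_ , PW.hom r) , (_ , PW.hom s)

    inner-homE : Inner RE x → Inner R (PE.π x)
    inner-homE ((_ , r) , (_ , s)) = (_ , PE.hom r) , (_ , PE.hom s)

    inner-a : Inner RW a
    inner-a = in-a , (_ , eW)

    inner-d : Inner RE d
    inner-d = (_ , eE) , out-d

  -- Transfer of walks, compasses and good edges between a cut graph and its pieces.

  module Transfer (C : Cut R RW RE V VW VE a b c d) where
    open Gluing C
    private
      module F = Gluing (cut-flip C)
      variable
        x y z w x₁ y₁ p q : A
        nE nW nEW nEE nWW nWE : Pole → A → A
        Y : Pole

    liftInW : HasOut RW x → R z (PW.π x) → ∃[ y ] RW y x × PW.π y ≡ z
    liftInW = F.liftOutE

    data InnerLift : A → Set ℓ where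
      innerW : Inner RW x → InnerLift (PW.π x)
      innerE : Inner RE x → InnerLift (PE.π x)

    -- The delicate case is a vertex entered by an edge of the W piece and left by an edge of the E
    -- piece. By `shared` it is a or d, and a is inner in the W piece, d in the E piece.
    inner-lift : Inner R x → InnerLift x
    inner-lift ((_ , r) , (_ , s)) with cover s
    ... | inj₁ (_ , _ , t , refl , _) with liftInW (_ , t) r
    ...   | _ , u , _ = innerW ((_ , u) , (_ , t))
    inner-lift ((_ , r) , (_ , s)) | inj₂ (_ , _ , t , refl , _) with cover r
    ... | inj₂ (_ , _ , u , _ , q) with PE.π-injective (proj₂ (endsE u)) (proj₁ (endsE t)) q
    ...   | refl = innerE ((_ , u) , (_ , t))
    inner-lift ((_ , r) , (_ , s)) | inj₂ (_ , _ , t , refl , _) | inj₁ (_ , _ , u , _ , q)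
      with shared (proj₂ (endsW u)) (proj₁ (endsE t)) q
    ... | inj₁ (refl , refl) = subst InnerLift πa≡πc (innerW inner-a)
    ... | inj₂ (refl , refl) = innerE inner-d

    data Split (x y z w : A) : Set ℓ where
      inW    : ∀ {x₁ y₁ z₁ w₁} → Walk RW x₁ y₁ z₁ w₁ →
               PW.π x₁ ≡ x → PW.π y₁ ≡ y → PW.π z₁ ≡ z → PW.π w₁ ≡ w → Split x y z w
      inE    : ∀ {x₁ y₁ z₁ w₁} → Walk RE x₁ y₁ z₁ w₁ →
               PE.π x₁ ≡ x → PE.π y₁ ≡ y → PE.π z₁ ≡ z → PE.π w₁ ≡ w → Split x y z w
      across : ∀ {x₁ y₁ z₁ w₁} → Walk RW x₁ y₁ a b → Walk RE c d z₁ w₁ →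
               PW.π x₁ ≡ x → PW.π y₁ ≡ y → PE.π z₁ ≡ z → PE.π w₁ ≡ w → Split x y z w

    split : Walk R x y z w → Split x y z w
    split (one r) with cover r
    ... | inj₁ (_ , _ , s , p , q) = inW (one s) p q p q
    ... | inj₂ (_ , _ , s , p , q) = inE (one s) p q p q
    split (r ◂ t) with split t
    ... | inW s refl q₁ q₂ q₃ with liftInW (_ , first s) r
    ...   | _ , u , p = inW (u ◂ s) p refl q₂ q₃
    split (r ◂ t) | across s s′ refl q₁ q₂ q₃ with liftInW (_ , first s) r
    ...   | _ , u , p = across (u ◂ s) s′ p refl q₂ q₃
    split (r ◂ t) | inE s q₀ q₁ q₂ q₃ with cover r
    ...   | inj₂ (_ , _ , u , p , q)
      with PE.π-injective (proj₂ (endsE u)) (proj₁ (endsE (first s))) (trans q (sym q₀))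
    ...     | refl = inE (u ◂ s) p q q₂ q₃
    split (r ◂ t) | inE s q₀ q₁ q₂ q₃ | inj₁ (_ , _ , u , p , q)
      with shared (proj₂ (endsW u)) (proj₁ (endsE (first s))) (trans q (sym q₀))
    -- The walk in the E piece starts at d, so the edge put in front of it is the new edge.
    ... | inj₂ (refl , refl) with only-b u
    ...   | refl = across (one eW) (eE ◂ s) p q q₂ q₃
    -- The lifted walk starts at c, so its first edge is already the new edge, and the edge put in
    -- front of it ends in a.
    split (r ◂ t) | inE s q₀ q₁ q₂ q₃ | inj₁ (_ , _ , u , p , q)
        | inj₁ (refl , refl) with only-c (first s)
    ...   | refl = across (u ◂ one eW) s p q q₂ q₃

    -- A lift to the E piece of a walk starting at an inner vertex can start at
    -- c; such a walk starts with the new edge, hence is across.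
    data SplitFrom (x y z w : A) : Set ℓ where
      inW    : ∀ {x₁ y₁ z₁ w₁} → Walk RW x₁ y₁ z₁ w₁ → Inner RW x₁ →
               PW.π x₁ ≡ x → PW.π y₁ ≡ y → PW.π z₁ ≡ z → PW.π w₁ ≡ w → SplitFrom x y z w
      inE    : ∀ {x₁ y₁ z₁ w₁} → Walk RE x₁ y₁ z₁ w₁ → Inner RE x₁ →
               PE.π x₁ ≡ x → PE.π y₁ ≡ y → PE.π z₁ ≡ z → PE.π w₁ ≡ w → SplitFrom x y z w
      across : ∀ {x₁ y₁ z₁ w₁} → Walk RW x₁ y₁ a b → Inner RW x₁ → Walk RE c d z₁ w₁ →
               PW.π x₁ ≡ x → PW.π y₁ ≡ y → PE.π z₁ ≡ z → PE.π w₁ ≡ w → SplitFrom x y z w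

    split-from : Inner R x → Walk R x y z w → SplitFrom x y z w
    split-from ((_ , r) , _) t with split t
    ... | inW s refl q₁ q₂ q₃ with liftInW (_ , first s) r
    ...   | _ , u , _ = inW s ((_ , u) , (_ , first s)) refl q₁ q₂ q₃
    split-from ((_ , r) , _) t | across s s′ refl q₁ q₂ q₃ with liftInW (_ , first s) r
    ...   | _ , u , _ = across s ((_ , u) , (_ , first s)) s′ refl q₁ q₂ q₃
    split-from ((_ , r) , _) t | inE s refl q₁ q₂ q₃ with cover r
    ... | inj₂ (_ , _ , u , p , q)
      with PE.π-injective (proj₂ (endsE u)) (proj₁ (endsE (first s))) q
    ...   | refl = inE s ((_ , u) , (_ , first s)) refl q₁ q₂ q₃
    split-from ((_ , r) , _) t | inE s refl q₁ q₂ q₃ | inj₁ (_ , _ , u , p , q)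
      with shared (proj₂ (endsW u)) (proj₁ (endsE (first s))) q
    ... | inj₂ (refl , refl) = inE s ((_ , eE) , (_ , first s)) refl q₁ q₂ q₃
    ... | inj₁ (refl , refl) with only-c (first s)
    ...   | refl = across (one eW) inner-a s πa≡πc (trans πb≡πd q₁) q₂ q₃

    -- The restriction to inner vertices leaves out b: its image d takes its compass from the E
    -- piece.
    CompatW : (n m : Pole → A → A) → Set ℓ
    CompatW n m = ∀ Y {x} → Inner RW x → n Y (PW.π x) ≡ PW.π (m Y x)

    CompatE : (n m : Pole → A → A) → Set ℓ
    CompatE n m = ∀ Y {x} → Inner RE x → n Y (PE.π x) ≡ PE.π (m Y x)

    -- Edges lifted to different pieces can have a common target only in a or d, and both of these
    -- have outgoing edges, so no E-edge loses functionality. Separation at an inner vertex concerns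
    -- edges that all lift to one piece.
    half-glue : CompatW nE nEW → CompatE nE nEE → Half RW nEW → Half RE nEE → Half R nE
    half-glue {nE} {nEW} {nEE} kW kE HW HE = record
      { points = pts ; functional = fun ; separates = sep }
      where
      module HW = Half HW
      module HE = Half HE
      pts : ∀ Y {x} → Inner R x → R x (nE Y x)
      pts Y i with inner-lift i
      ... | innerW j = subst (R _) (sym (kW Y j)) (PW.hom (HW.points Y j))
      ... | innerE j = subst (R _) (sym (kE Y j)) (PE.hom (HE.points Y j))
      fun : ∀ {x x′ y} → R x y → R x′ y → x′ ≡ x ⊎ HasOut R y
      fun r r′ with cover r
      fun r r′ | inj₁ (_ , y₁ , s , refl , refl) with cover r′
      ... | inj₁ (_ , _ , s′ , refl , q)
        with PW.π-injective (proj₂ (endsW s′)) (proj₂ (endsW s)) q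
      ...   | refl with HW.functional s s′
      ...     | inj₁ refl = inj₁ refl
      ...     | inj₂ (_ , u) = inj₂ (_ , PW.hom u)
      fun r r′ | inj₁ (_ , y₁ , s , refl , refl) | inj₂ (_ , _ , s′ , _ , q)
        with shared (proj₂ (endsW s)) (proj₂ (endsE s′)) (sym q)
      ... | inj₁ (refl , _) = inj₂ (_ , PW.hom eW)
      ... | inj₂ (refl , refl) = inj₂ (subst (HasOut R) (sym πb≡πd) (_ , PE.hom (proj₂ out-d)))
      fun r r′ | inj₂ (_ , y₁ , s , refl , refl) with cover r′
      ... | inj₂ (_ , _ , s′ , refl , q)
        with PE.π-injective (proj₂ (endsE s′)) (proj₂ (endsE s)) q
      ...   | refl with HE.functional s s′
      ...     | inj₁ refl = inj₁ refl
      ...     | inj₂ (_ , u) = inj₂ (_ , PE.hom u)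
      fun r r′ | inj₂ (_ , y₁ , s , refl , refl) | inj₁ (_ , _ , s′ , _ , q)
        with shared (proj₂ (endsW s′)) (proj₂ (endsE s)) q
      ... | inj₁ (_ , refl) = ⊥-elim (no-in-c s)
      ... | inj₂ (refl , refl) = inj₂ (_ , PE.hom (proj₂ out-d))
      sep : ∀ {x y} → Inner R x → nE N x ≡ nE S x → R x y → y ≡ nE N x
      sep i eq r with inner-lift i
      ... | innerW j with liftOutW (proj₂ j) r
      ...   | _ , s , refl = trans (cong PW.π (HW.separates j eq′ s)) (sym (kW N j))
        where
        eq′ = PW.π-injective (proj₂ (endsW (HW.points N j))) (proj₂ (endsW (HW.points S j)))
                (trans (sym (kW N j)) (trans eq (kW S j)))
      sep i eq r | innerE j with liftOutE (proj₁ j) r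
      ...   | _ , s , refl = trans (cong PE.π (HE.separates j eq′ s)) (sym (kE N j))
        where
        eq′ = PE.π-injective (proj₂ (endsE (HE.points N j))) (proj₂ (endsE (HE.points S j)))
                (trans (sym (kE N j)) (trans eq (kE S j)))

    decent-glue :
      CompatW nE nEW → CompatE nE nEE → CompatW nW nWW → CompatE nW nWE →
      Decent RW nEW nWW → Decent RE nEE nWE →
      (∀ Y → Good RW nEW Y a b ⊎ Good (flip RE) nWE Y d c) →
      Decent R nE nW
    decent-glue kEW kEE kWW kWE dW dE good Y t i j
      with split-from i t | inner-lift j
    ... | inW s k refl q₁ q₂ q₃ | innerW l
      with PW.π-injective (proj₂ (endsW (final s))) (proj₁ (endsW (proj₂ (proj₂ l)))) q₃
    ...   | refl with dW Y s k l
    ...     | inj₁ eq = inj₁ (trans (kEW Y k) (trans (cong PW.π eq) q₁))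
    ...     | inj₂ eq = inj₂ (trans (kWW Y l) (trans (cong PW.π eq) q₂))
    decent-glue kEW kEE kWW kWE dW dE good Y t i j
        | inE s k refl q₁ q₂ q₃ | innerE l
      with PE.π-injective (proj₂ (endsE (final s))) (proj₁ (endsE (proj₂ (proj₂ l)))) q₃
    ...   | refl with dE Y s k l
    ...     | inj₁ eq = inj₁ (trans (kEE Y k) (trans (cong PE.π eq) q₁))
    ...     | inj₂ eq = inj₂ (trans (kWE Y l) (trans (cong PE.π eq) q₂))
    decent-glue kEW kEE kWW kWE dW dE good Y t i j
        | across s k s′ refl q₁ q₂ q₃ | innerE l
      with PE.π-injective (proj₂ (endsE (final s′))) (proj₁ (endsE (proj₂ (proj₂ l)))) q₃ | good Y
    ...   | refl | inj₁ g = inj₁ (trans (kEW Y k) (trans (cong PW.π (g s k)) q₁))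
    ...   | refl | inj₂ g = inj₂ (trans (kWE Y l) (trans (cong PE.π (g (reverse s′) (swap l))) q₂))
    decent-glue kEW kEE kWW kWE dW dE good Y t i j
        | inW s k refl q₁ q₂ q₃ | innerE l
      with shared (proj₂ (endsW (final s))) (proj₁ (endsE (proj₂ (proj₂ l)))) q₃
    ...   | inj₁ (refl , refl) = ⊥-elim (no-in-c (proj₂ (proj₁ l)))
    -- The walk ends with the new edge, so its E part is the single edge (c , d).
    ...   | inj₂ (refl , refl) with only-b (final s) | good Y
    ...     | refl | inj₁ g = inj₁ (trans (kEW Y k) (trans (cong PW.π (g s k)) q₁))
    ...     | refl | inj₂ g = inj₂ (trans (kWE Y l)
      (trans (cong PE.π (g (one eE) (swap l))) (trans (sym πa≡πc) q₂)))
    decent-glue kEW kEE kWW kWE dW dE good Y t i j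
        | inE s k refl q₁ q₂ q₃ | innerW l
      with shared (proj₁ (endsW (proj₂ (proj₂ l)))) (proj₂ (endsE (final s))) (sym q₃)
    ...   | inj₁ (refl , refl) = ⊥-elim (no-in-c (final s))
    ...   | inj₂ (refl , _) = ⊥-elim (no-out-b (proj₂ (proj₂ l)))
    decent-glue kEW kEE kWW kWE dW dE good Y t i j
        | across s k s′ refl q₁ q₂ q₃ | innerW l
      with shared (proj₁ (endsW (proj₂ (proj₂ l)))) (proj₂ (endsE (final s′))) (sym q₃)
    ...   | inj₁ (refl , refl) = ⊥-elim (no-in-c (final s′))
    ...   | inj₂ (refl , _) = ⊥-elim (no-out-b (proj₂ (proj₂ l)))

    bridges-glue : (∀ {x y} → RW x y → Bridge RW x y) → (∀ {x y} → RE x y → Bridge RE x y) →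
                   R x y → Bridge R x y
    bridges-glue bW bE r with cover r
    ... | inj₁ (_ , _ , s , refl , refl) = PW.bridge s (bW s)
    ... | inj₂ (_ , _ , s , refl , refl) = bridge-flip (PE.bridge s (bridge-flip (bE s)))

    fixW : RW p q → q ≢ b → PW.π p ≡ p × PW.π q ≡ q
    fixW r q≢b = PW.π-source r , PW.π-≢ q≢b

    fixE : RE p q → p ≢ c → PE.π p ≡ p × PE.π q ≡ q
    fixE r p≢c = PE.π-≢ p≢c , PE.π-source r

    ending≢d : ¬ HasOut RE q → q ≢ d
    ending≢d ¬o refl = ¬o out-d

    -- Such an edge cannot start in c: it would be (c , d), and d has outgoing edges.
    ending-fixE : RE p q → ¬ HasOut RE q → PE.π p ≡ p × PE.π q ≡ q
    ending-fixE r ¬o = fixE r λ { refl → ending≢d ¬o (only-c r) }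

    walk-across : Walk RW p q a b → Walk RE c d x y → Walk R (PW.π p) (PW.π q) (PE.π x) (PE.π y)
    walk-across t s = map PW.π PW.hom t ⊙
      subst₂ (λ u v → Walk R u v _ _) (sym πa≡πc) (sym πb≡πd) (map PE.π PE.hom s)

    -- If (a , b) is the edge YE of the W piece, then YE of the E piece becomes
    -- that of the cut graph.
    distinguishedE : CompatW nE nEW → CompatE nE nEE →
      Distinguished RW nEW Y a b → Distinguished RE nEE Y p q →
      Distinguished R nE Y p q
    distinguishedE {nE} {Y = Y} {p} {q} kW kE DW DE =
      subst₂ (Distinguished R nE Y) (proj₁ fixed) (proj₂ fixed) record
      { edge = PE.hom DE.edge ; no-out = no-out ; good = good }
      where
      module DW = Distinguished DW
      module DE = Distinguished DE
      no-out : ¬ HasOut R (PE.π q)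
      no-out (_ , r) = DE.no-out (_ , proj₁ (proj₂ (liftOutE (_ , DE.edge) r)))
      fixed = ending-fixE DE.edge DE.no-out
      q≢c : q ≢ c
      q≢c refl = no-in-c DE.edge
      good : Good R nE Y (PE.π p) (PE.π q)
      good t i with split-from i t
      -- A walk coming from the W piece has passed through (a , b), and goodness of that edge
      -- already determines its first edge.
      ... | across s k s′ refl q₁ q₂ q₃ = trans (kW Y k) (trans (cong PW.π (DW.good s k)) q₁)
      ... | inW s k _ _ _ q₃ with shared (proj₂ (endsW (final s))) (proj₂ (endsE DE.edge)) q₃
      ...   | inj₁ (_ , eq) = ⊥-elim (q≢c eq)
      ...   | inj₂ (_ , eq) = ⊥-elim (ending≢d DE.no-out eq)
      good t i | inE s k refl q₁ q₂ q₃
        with PE.π-injective (proj₁ (endsE (final s))) (proj₁ (endsE DE.edge)) q₂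
           | PE.π-injective (proj₂ (endsE (final s))) (proj₂ (endsE DE.edge)) q₃
      ... | refl | refl = trans (kE Y k) (trans (cong PE.π (DE.good s k)) q₁)

    -- Walks never return from the E piece to the W piece, so a walk ending in this edge lies in the
    -- W piece altogether and goodness there is enough.
    distinguishedW : CompatW nE nEW →
      Distinguished RW nEW Y p q → q ≢ b → Distinguished R nE Y p q
    distinguishedW {nE} {Y = Y} {p} {q} kW DW q≢b =
      subst₂ (Distinguished R nE Y) (proj₁ fixed) (proj₂ fixed) record
      { edge = PW.hom DW.edge ; no-out = no-out ; good = good }
      where
      module DW = Distinguished DW
      fixed = fixW DW.edge q≢b
      q≢a : q ≢ a
      q≢a refl = DW.no-out (_ , eW)
      notE : ∀ {w} → VE w → PE.π w ≡ PW.π q → ⊥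
      notE i eq with shared (proj₂ (endsW DW.edge)) i (sym eq)
      ... | inj₁ (eq′ , _) = q≢a eq′
      ... | inj₂ (eq′ , _) = q≢b eq′
      no-out : ¬ HasOut R (PW.π q)
      no-out (_ , r) with cover r
      ... | inj₂ (_ , _ , s , eq , _) = notE (proj₁ (endsE s)) eq
      ... | inj₁ (_ , _ , s , eq , _)
        with PW.π-injective (proj₁ (endsW s)) (proj₂ (endsW DW.edge)) eq
      ...   | refl = DW.no-out (_ , s)
      good : Good R nE Y (PW.π p) (PW.π q)
      good t i with split-from i t
      ... | across s k s′ refl q₁ q₂ q₃ = ⊥-elim (notE (proj₂ (endsE (final s′))) q₃)
      ... | inE s k refl q₁ q₂ q₃ = ⊥-elim (notE (proj₂ (endsE (final s))) q₃)
      ... | inW s k refl q₁ q₂ q₃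
        with PW.π-injective (proj₁ (endsW (final s))) (proj₁ (endsW DW.edge)) q₂
           | PW.π-injective (proj₂ (endsW (final s))) (proj₂ (endsW DW.edge)) q₃
      ... | refl | refl = trans (kW Y k) (trans (cong PW.π (DW.good s k)) q₁)

    -- The compass inherited by a piece: where the given compass chooses the new edge, the piece
    -- chooses (a , b) or (c , d) instead.
    ρW ρE : (Pole → A → A) → Pole → A → A
    ρW n Y x = PW.ρ (n Y (PW.π x))
    ρE n Y x = PE.ρ (n Y (PE.π x))

    half-pieceE : Half R nE → Half RW (ρW nE)
    half-pieceE {nE} H = record { points = pts ; functional = fun ; separates = sep }
      where
      open Half H
      pts : ∀ Y {x} → Inner RW x → RW x (ρW nE Y x)
      pts Y i with liftOutW (proj₂ i) (points Y (inner-homW i))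
      ... | _ , s , eq =
        subst (RW _) (trans (sym (PW.retract (proj₂ (endsW s)))) (cong PW.ρ eq)) s
      fun : ∀ {x x′ y} → RW x y → RW x′ y → x′ ≡ x ⊎ HasOut RW y
      fun r r′ with functional (PW.hom r) (PW.hom r′)
      ... | inj₁ eq = inj₁ (PW.π-injective (proj₁ (endsW r′)) (proj₁ (endsW r)) eq)
      ... | inj₂ (_ , s) with cover s
      ...   | inj₁ (_ , _ , t , eq , _)
        with PW.π-injective (proj₁ (endsW t)) (proj₂ (endsW r)) eq
      ...     | refl = inj₂ (_ , t)
      fun r r′ | inj₂ (_ , s) | inj₂ (_ , _ , t , eq , _)
        with shared (proj₂ (endsW r)) (proj₁ (endsE t)) (sym eq)
      ...     | inj₁ (refl , _) = inj₂ (_ , eW)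
      ...     | inj₂ (refl , _) = inj₁ (trans (only-b r′) (sym (only-b r)))
      sep : ∀ {x y} → Inner RW x → ρW nE N x ≡ ρW nE S x → RW x y → y ≡ ρW nE N x
      sep i eq r
        with liftOutW (proj₂ i) (points N (inner-homW i)) | liftOutW (proj₂ i) (points S (inner-homW i))
      ... | _ , s , p | _ , s′ , p′ =
        trans (sym (PW.retract (proj₂ (endsW r))))
          (cong PW.ρ (separates (inner-homW i) (trans (sym p) (trans (cong PW.π eq′) p′)) (PW.hom r)))
        where
        eq′ = trans (sym (PW.retract (proj₂ (endsW s))))
               (trans (cong PW.ρ p) (trans eq
                 (trans (cong PW.ρ (sym p′)) (PW.retract (proj₂ (endsW s′))))))

    -- This is not the dual of `half-pieceE`, since both concern the W piece. That piece gains the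
    -- E-vertex b but no new W-vertex, so lifting incoming edges is sufficient.
    half-pieceW : Half (flip R) nW → Half (flip RW) (ρW nW)
    half-pieceW {nW} H = record { points = pts ; functional = fun ; separates = sep }
      where
      open Half H
      pts : ∀ Y {x} → Inner (flip RW) x → RW (ρW nW Y x) x
      pts Y i with liftInW (proj₁ i) (points Y (swap (inner-homW (swap i))))
      ... | _ , s , eq =
        subst (λ v → RW v _) (trans (sym (PW.retract (proj₁ (endsW s)))) (cong PW.ρ eq)) s
      fun : ∀ {x x′ y} → RW y x → RW y x′ → x′ ≡ x ⊎ HasIn RW y
      fun r r′ with functional (PW.hom r) (PW.hom r′)
      ... | inj₁ eq = inj₁ (PW.π-injective (proj₂ (endsW r′)) (proj₂ (endsW r)) eq)
      ... | inj₂ (_ , s) with liftInW (_ , r) s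
      ...   | _ , t , _ = inj₂ (_ , t)
      sep : ∀ {x y} → Inner (flip RW) x → ρW nW N x ≡ ρW nW S x → RW y x → y ≡ ρW nW N x
      sep i eq r
        with liftInW (proj₁ i) (points N (swap (inner-homW (swap i))))
           | liftInW (proj₁ i) (points S (swap (inner-homW (swap i))))
      ... | _ , s , p | _ , s′ , p′ =
        trans (sym (PW.retract (proj₁ (endsW r))))
          (cong PW.ρ (separates (swap (inner-homW (swap i)))
            (trans (sym p) (trans (cong PW.π eq′) p′)) (PW.hom r)))
        where
        eq′ = trans (sym (PW.retract (proj₁ (endsW s))))
               (trans (cong PW.ρ p) (trans eq
                 (trans (cong PW.ρ (sym p′)) (PW.retract (proj₁ (endsW s′))))))

    -- Walks are pushed into the cut graph by `π`, and bridge colourings are restricted along it.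
    -- Connectedness uses `ρ` instead: a colouring of the piece is extended to the cut graph by
    -- giving the E piece the colour of b.
    compassGraph-pieceW : CompassGraph R V nE nW → CompassGraph RW VW (ρW nE) (ρW nW)
    compassGraph-pieceW {nE} {nW} G = record
      { halfE = half-pieceE halfE
      ; halfW = half-pieceW halfW
      ; decent = dec
      ; bridges = br
      ; connected = conn
      ; has-inner = a , inner-a
      }
      where
      open CompassGraph G
      dec : Decent RW (ρW nE) (ρW nW)
      dec Y t i j with decent Y (map PW.π PW.hom t) (inner-homW i) (inner-homW j)
      ... | inj₁ eq = inj₁ (trans (cong PW.ρ eq) (PW.retract (proj₂ (endsW (first t)))))
      ... | inj₂ eq = inj₂ (trans (cong PW.ρ eq) (PW.retract (proj₁ (endsW (final t)))))
      br : ∀ {x y} → RW x y → Bridge RW x y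
      br r with bridges (PW.hom r)
      ... | bridge-by f fx fy k = bridge-by (f ∘ PW.π) fx fy go
        where
        go : ∀ {u v} → RW u v → _
        go s with k (PW.hom s)
        ... | inj₁ eq = inj₁ eq
        ... | inj₂ (p , q) = inj₂ (PW.π-injective (proj₁ (endsW s)) (proj₁ (endsW r)) p
                                  , PW.π-injective (proj₂ (endsW s)) (proj₂ (endsW r)) q)
      conn : Connected RW VW
      conn f k i j =
        trans (cong f (sym (PW.retract i)))
          (trans (connected (f ∘ PW.ρ) go (PW.vertex V-d i) (PW.vertex V-d j)) (cong f (PW.retract j)))
        where
        go : ∀ {u v} → R u v → f (PW.ρ u) ≡ f (PW.ρ v)
        go r with PW.collapse r
        ... | inj₁ s = k s
        ... | inj₂ eq = cong f eq

    bad-homW : ∀ nE Y → Bad RW (ρW nE) Y p q → Bad R nE Y (PW.π p) (PW.π q)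
    bad-homW nE Y = bad-map nE Y PW.π PW.ρ PW.hom (λ r → PW.retract (proj₂ (endsW r)))

    bad-homE : ∀ nE Y → Bad RE (ρE nE) Y p q → Bad R nE Y (PE.π p) (PE.π q)
    bad-homE nE Y = bad-map nE Y PE.π PE.ρ PE.hom (λ r → PE.retract (proj₂ (endsE r)))

    bad-homE-flip : ∀ nW Y → Bad (flip RE) (ρE nW) Y p q → Bad (flip R) nW Y (PE.π p) (PE.π q)
    bad-homE-flip nW Y = bad-map nW Y PE.π PE.ρ PE.hom (λ r → PE.retract (proj₁ (endsE r)))

    not-both-bad : CompassGraph R V nE nW → Bad RW (ρW nE) Y a b →
                   Bad (flip RE) (ρE nW) Y d c → ⊥
    not-both-bad {nE = nE} {nW} {Y} G β γ
      with bad-homW nE Y β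
         | bad-homE-flip nW Y γ
    ... | _ , _ , t , i , ne | _ , _ , s , j , ne′
      with CompassGraph.decent G Y (t ⊙ subst₂ (λ u v → Walk R u v _ _) (sym πa≡πc) (sym πb≡πd)
                                      (reverse s)) i (swap j)
    ...   | inj₁ eq = ne eq
    ...   | inj₂ eq = ne′ eq

    ending-lift : R x y → ¬ HasOut R y →
      (RW x y × y ≢ b × ¬ HasOut RW y × PW.π x ≡ x × PW.π y ≡ y) ⊎
      (RE x y × ¬ HasOut RE y × PE.π x ≡ x × PE.π y ≡ y)
    ending-lift r ¬o with R⇒ r
    ... | inj₁ (s , y≢b) = let p , q = fixW s y≢b in
      inj₁ (s , y≢b , (λ (_ , t) → ¬o (_ , subst (λ v → R v _) q (PW.hom t))) , p , q)
    ... | inj₂ (inj₁ (s , x≢c)) = let p , q = fixE s x≢c in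
      inj₂ (s , (λ (_ , t) → ¬o (_ , subst (λ v → R v _) q (PE.hom t))) , p , q)
    ... | inj₂ (inj₂ (_ , refl)) =
      ⊥-elim (¬o (_ , subst (λ v → R v _) (PE.π-source eE) (PE.hom (proj₂ out-d))))

    -- The cut removes (a , b), the one E-edge of the W piece not known to be bad; so the candidate
    -- can come only from the E piece.
    only-goodE : ∀ nE Y → OnlyGood RW (ρW nE) Y a b → OnlyGood RE (ρE nE) Y p q → OnlyGood R nE Y p q
    only-goodE nE Y uW uE r ¬o with ending-lift r ¬o
    ... | inj₁ (s , y≢b , ¬o′ , p , q) with uW s ¬o′
    ...   | inj₁ (_ , eq) = ⊥-elim (y≢b eq)
    ...   | inj₂ β = inj₂ (subst₂ (Bad R nE Y) p q (bad-homW nE Y β))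
    only-goodE nE Y uW uE r ¬o | inj₂ (s , ¬o′ , p , q) with uE s ¬o′
    ... | inj₁ eq = inj₁ eq
    ... | inj₂ β = inj₂ (subst₂ (Bad R nE Y) p q (bad-homE nE Y β))

    -- The candidate (z , w) of the E piece has to be refuted. A bad walk to (a , b), prolonged by
    -- the walk from (c , d) to (z , w), keeps its first edge and so shows that (z , w) is bad.
    only-goodW : ∀ nE Y → Bad RW (ρW nE) Y a b → OnlyGood RW (ρW nE) Y p q →
              Walk RE c d z w → OnlyGood RE (ρE nE) Y z w → OnlyGood R nE Y p q
    only-goodW nE Y β uW t uE r ¬o with ending-lift r ¬o
    ... | inj₁ (s , _ , ¬o′ , p , q) with uW s ¬o′
    ...   | inj₁ eq = inj₁ eq
    ...   | inj₂ γ = inj₂ (subst₂ (Bad R nE Y) p q (bad-homW nE Y γ))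
    only-goodW nE Y β uW t uE r ¬o | inj₂ (s , ¬o′ , p , q) with uE s ¬o′
    ... | inj₂ γ = inj₂ (subst₂ (Bad R nE Y) p q (bad-homE nE Y γ))
    ... | inj₁ (refl , refl) with bad-homW nE Y β
    ...   | _ , _ , s′ , i , ne = inj₂ (subst₂ (Bad R nE Y) p q (_ , _ , s′ ⊙
      subst₂ (λ u v → Walk R u v _ _) (sym πa≡πc) (sym πb≡πd) (map PE.π PE.hom t) , i , ne))

-- Vertex lists of walks, and simple walks.

module Lists {ℓ : Level} {A : Set ℓ} where

  private variable
    R P : A → A → Set ℓ
    x y z u v w : A
    l : List A

  -- With `two-distinct` this translates between the degree condition on N and S and its form
  -- without counting: if N and S agree, there is only one edge to choose.
  short-constant : ¬ 2 ≤ length l → x ∈ l → y ∈ l → x ≡ y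
  short-constant {_ ∷ []}    _  (here refl) (here refl) = refl
  short-constant {_ ∷ _ ∷ _} ¬2 _ _ = ⊥-elim (¬2 (s≤s (s≤s z≤n)))

  two-distinct : Unique l → 2 ≤ length l → ∃₂ λ x y → x ∈ l × y ∈ l × x ≢ y
  two-distinct {_ ∷ _ ∷ _} ((x≢y ∷ _) ∷ _) _ = _ , _ , here refl , there (here refl) , x≢y
  two-distinct {_ ∷ []} _ (s≤s ())

  trace : Walk R x y z w → List A
  trace (one {x} {y} _) = x ∷ y ∷ []
  trace (_◂_ {x} _ t) = x ∷ trace t

  trace-head : (t : Walk R x y z w) → ∃[ zs ] trace t ≡ x ∷ y ∷ zs
  trace-head (one _) = [] , refl
  trace-head (r ◂ t) with trace-head t
  ... | _ , eq = _ , cong (_ ∷_) eq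

  trace-last : (t : Walk R x y z w) → ∃[ zs ] trace t ≡ zs ++ z ∷ w ∷ []
  trace-last (one _) = [] , refl
  trace-last (r ◂ t) with trace-last t
  ... | zs , eq = _ ∷ zs , cong (_ ∷_) eq

  trace-linked : (t : Walk R x y z w) → Linked R (trace t)
  trace-linked (one r) = r ∷ [-]
  trace-linked (r ◂ t) with trace t | trace-head t | trace-linked t
  ... | _ | _ , refl | ls = r ∷ ls

  trace-inner : (t : Walk R x y z w) → Inner R x → Inner R w → All (Inner R) (trace t)
  trace-inner (one _) i j = i ∷ j ∷ []
  trace-inner (r ◂ t) i j = i ∷ trace-inner t ((_ , r) , (_ , first t)) j

  trace-member : (t : Walk R x y z w) → v ∈ trace t → v ≡ x ⊎ ∃[ u ] Walk R x y u v
  trace-member (one _) (here eq) = inj₁ eq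
  trace-member (one r) (there (here refl)) = inj₂ (_ , one r)
  trace-member (r ◂ t) (here eq) = inj₁ eq
  trace-member (r ◂ t) (there m) with trace-member t m
  ... | inj₁ refl = inj₂ (_ , one r)
  ... | inj₂ (_ , s) = inj₂ (_ , r ◂ s)

  -- A second occurrence of the first vertex would end a walk that returns to the source of a bridge
  -- after crossing it.
  trace-unique : (∀ {x y} → R x y → Bridge R x y) → (∀ {x} → ¬ R x x) →
                 (t : Walk R x y z w) → Unique (trace t)
  trace-unique br irr (one r) = ((λ { refl → irr r }) ∷ []) ∷ [] ∷ []
  trace-unique br irr (r ◂ t) = ¬Any⇒All¬ _ new ∷ trace-unique br irr t
    where
    new : _ ∉ trace t
    new m with trace-member t m
    ... | inj₁ refl = irr r
    ... | inj₂ (_ , s) = bridge-no-return (br r) s refl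

  linked-walk : Linked R (x ∷ y ∷ l) →
                ∃[ zs ] ∃[ z ] ∃[ w ] x ∷ y ∷ l ≡ zs ++ z ∷ w ∷ [] × Walk R x y z w
  linked-walk (r ∷ [-]) = [] , _ , _ , refl , one r
  linked-walk {x = x} (r ∷ ls@(_ ∷ _)) with linked-walk ls
  ... | zs , _ , _ , eq , t = x ∷ zs , _ , _ , cong (x ∷_) eq , r ◂ t

  last-two-injective : ∀ ys zs → ys ++ x ∷ y ∷ [] ≡ zs ++ u ∷ v ∷ [] → x ≡ u × y ≡ v
  last-two-injective {x} {y} {u} {v} ys zs eq
    with ∷ʳ-injective (ys ∷ʳ x) (zs ∷ʳ u)
           (trans (++-assoc ys _ _) (trans eq (sym (++-assoc zs _ _))))
  ... | eq′ , q = proj₂ (∷ʳ-injective ys zs eq′) , q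

  data Simple (P : A → A → Set ℓ) : A → A → List A → Set ℓ where
    stop : Simple P x x (x ∷ [])
    step : P x z → x ∉ l → Simple P z y l → Simple P x y (x ∷ l)

  simple-suffix : Simple P z y l → x ∈ l → ∃[ l′ ] Simple P x y l′
  simple-suffix s@stop (here refl) = _ , s
  simple-suffix s@(step _ _ _) (here refl) = _ , s
  simple-suffix (step _ _ s) (there m) = simple-suffix s m

  -- If the new first vertex occurs again later, the loop is dropped and the simple walk is resumed
  -- from that occurrence.
  loop-erase : DecidableEquality A → Star P x y → ∃[ l ] Simple P x y l
  loop-erase _≟_ ε = _ , stop
  loop-erase _≟_ (_◅_ {x} p s) with loop-erase _≟_ s
  ... | l , t with DecMembership._∈?_ _≟_ x l
  ...   | yes m = simple-suffix t m
  ...   | no ¬m = _ , (step p ¬m t)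

  simple-unique : Simple P x y l → Unique l
  simple-unique stop = [] ∷ []
  simple-unique (step _ n s) = ¬Any⇒All¬ _ n ∷ simple-unique s

  simple-linked : Simple P x y l → Linked P l
  simple-linked stop = [-]
  simple-linked (step p _ s@stop) = p ∷ simple-linked s
  simple-linked (step p _ s@(step _ _ _)) = p ∷ simple-linked s

  simple-closed : Simple P x y l → P y z → Linked P (l ∷ʳ z)
  simple-closed stop q = q ∷ [-]
  simple-closed (step p _ s@stop) q = p ∷ simple-closed s q
  simple-closed (step p _ s@(step _ _ _)) q = p ∷ simple-closed s q

  simple-head : Simple P x y l → head l ≡ just x
  simple-head stop = refl
  simple-head (step _ _ _) = refl

  simple-last : Simple P x y l → last l ≡ just y
  simple-last stop = refl
  simple-last (step _ _ s@stop) = simple-last s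
  simple-last (step _ _ s@(step _ _ _)) = simple-last s

  simple-nonempty : Simple P x y l → 1 ≤ length l
  simple-nonempty stop = s≤s z≤n
  simple-nonempty (step _ _ _) = s≤s z≤n

  simple-all : {Q : A → Set ℓ} → (∀ {x y} → P x y → Q x) → Q y → Simple P x y l → All Q l
  simple-all h q stop = q ∷ []
  simple-all h q (step p _ s) = h p ∷ simple-all h q s

  -- Meant for the part of a semicycle beyond its second vertex z: this part avoids z, hence also
  -- the edge between z and the starting vertex.
  linked-constant : ∀ {z} (f : A → Bool) (l : List A) →
    (∀ {u v} → P u v → u ≢ z → v ≢ z → f u ≡ f v) →
    Linked P (x ∷ l ∷ʳ y) → x ≢ z → All (_≢ z) l → y ≢ z → f x ≡ f y
  linked-constant f [] k (p ∷ [-]) x≢ _ y≢ = k p x≢ y≢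
  linked-constant f (u ∷ l) k (p ∷ ps) x≢ (u≢ ∷ us) y≢ =
    trans (k p x≢ u≢) (linked-constant f l k ps u≢ us y≢)

open Lists

-- Connected components of a finite list of edges.

module Components {ℓ : Level} {A : Set ℓ} (_≟_ : DecidableEquality A) where

  -- A representative of the component of a vertex, computed by merging
  -- components along the edges.
  rep : List (A × A) → A → A
  rep []             v = v
  rep ((x , y) ∷ es) v = if does (rep es v ≟ rep es x) then rep es y else rep es v

  Joined : List (A × A) → A → A → Set ℓ
  Joined es x y = (x , y) ∈ es ⊎ (y , x) ∈ es

  joined-sym : ∀ {es x y} → Joined es x y → Joined es y x
  joined-sym (inj₁ m) = inj₂ m
  joined-sym (inj₂ m) = inj₁ m

  joined-there : ∀ {e es x y} → Joined es x y → Joined (e ∷ es) x y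
  joined-there (inj₁ m) = inj₁ (there m)
  joined-there (inj₂ m) = inj₂ (there m)

  rep-constant : ∀ es {x y} → (x , y) ∈ es → rep es x ≡ rep es y
  rep-constant ((x , y) ∷ es) (here refl) with rep es x ≟ rep es x | rep es y ≟ rep es x
  ... | no ne | _     = ⊥-elim (ne refl)
  ... | yes _ | yes _ = refl
  ... | yes _ | no _  = refl
  rep-constant ((x , y) ∷ es) (there m) =
    cong (λ r → if does (r ≟ rep es x) then rep es y else r) (rep-constant es m)

  -- When the component of v is merged, the walk goes from v to the old representative, which is
  -- also that of x, back to x, over the added edge to y, and on to the representative of y.
  rep-joined : ∀ es v → Star (Joined es) v (rep es v)
  rep-joined [] v = ε
  rep-joined ((x , y) ∷ es) v with rep es v ≟ rep es x
  ... | no _  = Star.map joined-there (rep-joined es v)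
  ... | yes p =
    Star.map joined-there (subst (Star (Joined es) v) p (rep-joined es v))
      ◅◅ Star.reverse joined-sym (Star.map joined-there (rep-joined es x))
      ◅◅ inj₁ (here refl) ◅ Star.map joined-there (rep-joined es y)

-- Local compass graphs against relational compass graphs.

module Graphs {ℓ : Level} (𝒰 : VertexUniverse ℓ) where
  open KGraphs 𝒰
  open Components _≟_

  Arc : OrientedGraph → Vertex → Vertex → Set ℓ
  Arc D x y = (x , y) ∈ edges (digraph D)

  Node : OrientedGraph → Vertex → Set ℓ
  Node D x = x ∈ vertices (digraph D)

  module _ (D : OrientedGraph) where
    private
      G = digraph D
      _⟶_ = Arc D

    hasOut? : ∀ x → Dec (HasOut _⟶_ x)
    hasOut? x = map′ to from (any? (λ e → proj₁ e ≟ x) (edges G))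
      where
      to : Any (λ e → proj₁ e ≡ x) (edges G) → HasOut _⟶_ x
      to p with find p
      ... | _ , m , refl = _ , m
      from : HasOut _⟶_ x → Any (λ e → proj₁ e ≡ x) (edges G)
      from (_ , m) = lose m refl

    hasIn? : ∀ x → Dec (HasIn _⟶_ x)
    hasIn? x = map′ to from (any? (λ e → proj₂ e ≟ x) (edges G))
      where
      to : Any (λ e → proj₂ e ≡ x) (edges G) → HasIn _⟶_ x
      to p with find p
      ... | _ , m , refl = _ , m
      from : HasIn _⟶_ x → Any (λ e → proj₂ e ≡ x) (edges G)
      from (_ , m) = lose m refl

    inner? : ∀ x → Dec (Inner _⟶_ x)
    inner? x = hasIn? x ×-dec hasOut? x

    inner⁺ : ∀ {x} → IsInner G x → Inner _⟶_ x
    inner⁺ {x} (m , ¬w , ¬e) with hasIn? x | hasOut? x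
    ... | yes i | yes o = i , o
    ... | no ¬i | _     = ⊥-elim (¬w (m , λ u r → ¬i (u , r)))
    ... | _     | no ¬o = ⊥-elim (¬e (m , λ u r → ¬o (u , r)))

    inner⁻ : ∀ {x} → Inner _⟶_ x → IsInner G x
    inner⁻ ((u , r) , (v , s)) =
      proj₁ (endpoints G s) , (λ w → proj₂ w u r) , (λ e → proj₂ e v s)

    adjacent-node : ∀ {x y} → Adjacent G x y → Node D x
    adjacent-node (inj₁ r) = proj₁ (endpoints G r)
    adjacent-node (inj₂ r) = proj₂ (endpoints G r)

    module ToLocal {nE nW : Pole → Vertex → Vertex}
                   (C : CompassGraph _⟶_ (Node D) nE nW)
                   (walks : ∀ {x y} → Node D x → Node D y → Star (Adjacent G) x y) where
      open CompassGraph C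
      module HE = Half halfE
      module HW = Half halfW

      weakly-connected : IsWeaklyConnected G
      weakly-connected x y i j with loop-erase _≟_ (walks i j)
      ... | l , s = l , ((simple-nonempty s , simple-all adjacent-node j s , simple-linked s)
                        , simple-unique s)
                  , simple-head s , simple-last s

      -- The edge between a and z is a bridge, in one direction or the other. The rest of the cycle
      -- leads from z back to a by other edges, so the colouring of the bridge would agree at its
      -- two ends.
      no-cycle : ∀ a zs → Unique (a ∷ zs) → Linked (Adjacent G) (a ∷ zs ∷ʳ a) →
                 ¬ 4 ≤ length (a ∷ zs ∷ʳ a)
      no-cycle a [] _ _ (s≤s (s≤s ()))
      no-cycle a (z ∷ []) _ _ (s≤s (s≤s (s≤s ())))
      no-cycle a (z ∷ z′ ∷ zs) ((a≢z ∷ a≢z′ ∷ _) ∷ (z≢z′ ∷ z≢zs) ∷ _) (p ∷ q ∷ ps) _ = refute p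
        where
        close : (f : Vertex → Bool) → (∀ {u v} → Adjacent G u v → u ≢ a ⊎ v ≢ z →
                u ≢ z ⊎ v ≢ a → f u ≡ f v) → f a ≡ f z
        close f k = sym (trans (k q (inj₁ (≢-sym a≢z)) (inj₂ (≢-sym a≢z′)))
          (linked-constant f zs (λ r u≢ v≢ → k r (inj₂ v≢) (inj₁ u≢)) ps
            (≢-sym z≢z′) (All.map ≢-sym z≢zs) a≢z))
        clash : ∀ {b} → b ≡ true → b ≡ false → ⊥
        clash refl ()
        refute : Adjacent G a z → ⊥
        refute (inj₁ r) with bridges r
        ... | bridge-by f fa fz k = clash fa (trans (close f adj) fz)
          where
          adj : ∀ {u v} → Adjacent G u v → u ≢ a ⊎ v ≢ z → u ≢ z ⊎ v ≢ a → f u ≡ f v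
          adj (inj₁ s) n n′ with k s
          ... | inj₁ eq = eq
          adj (inj₁ s) (inj₁ n) n′ | inj₂ (eq , eq′) = ⊥-elim (n eq)
          adj (inj₁ s) (inj₂ n) n′ | inj₂ (eq , eq′) = ⊥-elim (n eq′)
          adj (inj₂ s) n n′ with k s
          ... | inj₁ eq = sym eq
          adj (inj₂ s) n (inj₁ n′) | inj₂ (eq , eq′) = ⊥-elim (n′ eq′)
          adj (inj₂ s) n (inj₂ n′) | inj₂ (eq , eq′) = ⊥-elim (n′ eq)
        refute (inj₂ r) with bridges r
        ... | bridge-by f fz fa k = clash fz (trans (sym (close f adj)) fa)
          where
          adj : ∀ {u v} → Adjacent G u v → u ≢ a ⊎ v ≢ z → u ≢ z ⊎ v ≢ a → f u ≡ f v
          adj (inj₁ s) n n′ with k s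
          ... | inj₁ eq = eq
          adj (inj₁ s) n (inj₁ n′) | inj₂ (eq , eq′) = ⊥-elim (n′ eq)
          adj (inj₁ s) n (inj₂ n′) | inj₂ (eq , eq′) = ⊥-elim (n′ eq′)
          adj (inj₂ s) n n′ with k s
          ... | inj₁ eq = sym eq
          adj (inj₂ s) (inj₁ n) n′ | inj₂ (eq , eq′) = ⊥-elim (n eq′)
          adj (inj₂ s) (inj₂ n) n′ | inj₂ (eq , eq′) = ⊥-elim (n eq)

      asemicyclic : IsAsemicyclic G
      asemicyclic _ ((_ , _ , ls) , 4≤ , a , zs , refl , u) = no-cycle a zs u ls 4≤

      𝓛 : LocalCompass
      𝓛 Y W x = nW Y x , x
      𝓛 Y E x = x , nE Y x

      separates : Separates G 𝓛
      separates x i W 2≤ eq with two-distinct (Unique.filter⁺ (λ e → proj₂ e ≟ x) (edges-unique G)) 2≤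
      ... | (y , _) , (z , _) , m , m′ , ne
        with ∈-filter⁻ (λ e → proj₂ e ≟ x) m | ∈-filter⁻ (λ e → proj₂ e ≟ x) m′
      ...   | r , refl | r′ , refl = ne (cong (_, x) (trans (eqn r) (sym (eqn r′))))
        where
        eqn : ∀ {y} → y ⟶ x → y ≡ nW N x
        eqn = HW.separates (swap (inner⁺ i)) (proj₁ (,-injective eq))
      separates x i E 2≤ eq with two-distinct (Unique.filter⁺ (λ e → proj₁ e ≟ x) (edges-unique G)) 2≤
      ... | (_ , y) , (_ , z) , m , m′ , ne
        with ∈-filter⁻ (λ e → proj₁ e ≟ x) m | ∈-filter⁻ (λ e → proj₁ e ≟ x) m′
      ...   | r , refl | r′ , refl = ne (cong (x ,_) (trans (eqn r) (sym (eqn r′))))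
        where
        eqn : ∀ {y} → x ⟶ y → y ≡ nE N x
        eqn = HE.separates (inner⁺ i) (proj₂ (,-injective eq))

      paths-decent : ∀ xs → IsPath G xs → All (IsInner G) xs → IsDecent G 𝓛 xs
      paths-decent [] (((() , _) , _) , _)
      paths-decent (x ∷ []) _ _ Y = inj₁ refl
      paths-decent (x ∷ y ∷ zs) (_ , ls) (i ∷ is) Y with linked-walk ls
      ... | ws , z , w , eq , t with All.lookup (subst (All (IsInner G)) eq (i ∷ is))
                                       (∈-++⁺ʳ ws (there (here refl)))
      ...   | j with decent Y t (inner⁺ i) (inner⁺ j)
      ...     | inj₁ p = inj₂ (inj₁ (x , y , zs , refl , i , cong (x ,_) p))
      ...     | inj₂ p = inj₂ (inj₂ (ws , z , w , eq , j , cong (_, w) p))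

      isLocalKGraph : IsLocalKGraph D
      isLocalKGraph = 𝓛 , record
        { local-compass    = λ Y a i → (_ , refl , HW.points Y (swap (inner⁺ i)))
                                     , (_ , refl , HE.points Y (inner⁺ i))
        ; weakly-connected = weakly-connected
        ; asemicyclic      = asemicyclic
        ; WE-functional    = (λ e w → w , λ c r → func (HW.functional (proj₁ w) r) (proj₂ (proj₂ w)))
                           , (λ e w → w , λ c r → func (HE.functional (proj₁ w) r) (proj₂ (proj₂ w)))
        ; has-inner        = proj₁ has-inner , inner⁻ (proj₂ has-inner)
        ; separates        = separates
        ; paths-decent     = paths-decent
        }
        where
        func : ∀ {x y} {P : Vertex → Set ℓ} → x ≡ y ⊎ ∃ P → (∀ u → ¬ P u) → x ≡ y
        func (inj₁ eq) _ = eq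
        func (inj₂ (u , p)) n = ⊥-elim (n u p)

    module FromLocal (𝓛 : LocalCompass) (L : IsLocalCompassGraph D 𝓛) where
      open IsLocalCompassGraph L

      nE nW : Pole → Vertex → Vertex
      nE Y x = proj₂ (𝓛 Y E x)
      nW Y x = proj₁ (𝓛 Y W x)

      𝓛E : ∀ Y {x} → IsInner G x → 𝓛 Y E x ≡ (x , nE Y x)
      𝓛E Y i with local-compass Y _ i
      ... | _ , (_ , eq , _) = trans eq (cong (_ ,_) (sym (cong proj₂ eq)))

      𝓛W : ∀ Y {x} → IsInner G x → 𝓛 Y W x ≡ (nW Y x , x)
      𝓛W Y i with local-compass Y _ i
      ... | (_ , eq , _) , _ = trans eq (cong (_, _) (sym (cong proj₁ eq)))

      arcE : ∀ Y {x} → IsInner G x → x ⟶ nE Y x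
      arcE Y i with local-compass Y _ i
      ... | _ , (_ , eq , r) = subst (λ e → _ ⟶ proj₂ e) (sym eq) r

      arcW : ∀ Y {x} → IsInner G x → nW Y x ⟶ x
      arcW Y i with local-compass Y _ i
      ... | (_ , eq , r) , _ = subst (λ e → proj₁ e ⟶ _) (sym eq) r

      halfE : Half _⟶_ nE
      halfE = record { points = λ Y i → arcE Y (inner⁻ i) ; functional = fun ; separates = sep }
        where
        fun : ∀ {x x′ y} → x ⟶ y → x′ ⟶ y → x′ ≡ x ⊎ HasOut _⟶_ y
        fun {x} {x′} {y} r r′ with hasOut? y
        ... | yes o = inj₂ o
        ... | no ¬o = inj₁ (proj₂ (proj₂ WE-functional (x , y)
                (r , (proj₂ (endpoints G r) , λ u s → ¬o (u , s)))) x′ r′)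
        sep : ∀ {x y} → Inner _⟶_ x → nE N x ≡ nE S x → x ⟶ y → y ≡ nE N x
        sep {x} i eq r = cong proj₂ (short-constant
          (λ 2≤ → separates x j E 2≤ (trans (𝓛E N j) (trans (cong (x ,_) eq) (sym (𝓛E S j)))))
          (∈-filter⁺ (λ e → proj₁ e ≟ x) r refl)
          (∈-filter⁺ (λ e → proj₁ e ≟ x) (arcE N j) refl))
          where j = inner⁻ i

      halfW : Half (flip _⟶_) nW
      halfW = record { points = λ Y i → arcW Y (inner⁻ (swap i)) ; functional = fun ; separates = sep }
        where
        fun : ∀ {x x′ y} → y ⟶ x → y ⟶ x′ → x′ ≡ x ⊎ HasIn _⟶_ y
        fun {x} {x′} {y} r r′ with hasIn? y
        ... | yes i = inj₂ i
        ... | no ¬i = inj₁ (proj₂ (proj₁ WE-functional (y , x)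
                (r , (proj₁ (endpoints G r) , λ u s → ¬i (u , s)))) x′ r′)
        sep : ∀ {x y} → Inner (flip _⟶_) x → nW N x ≡ nW S x → y ⟶ x → y ≡ nW N x
        sep {x} i eq r = cong proj₁ (short-constant
          (λ 2≤ → separates x j W 2≤ (trans (𝓛W N j) (trans (cong (_, x) eq) (sym (𝓛W S j)))))
          (∈-filter⁺ (λ e → proj₂ e ≟ x) r refl)
          (∈-filter⁺ (λ e → proj₂ e ≟ x) (arcW N j) refl))
          where j = inner⁻ (swap i)

      connected : Connected _⟶_ (Node D)
      connected f k i j with weakly-connected _ _ i j
      ... | xs , ((_ , _ , ls) , _) , p , q = go ls p q
        where
        adj : ∀ {u v} → Adjacent G u v → f u ≡ f v
        adj (inj₁ r) = k r
        adj (inj₂ r) = sym (k r)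
        go : ∀ {xs x y} → Linked (Adjacent G) xs → head xs ≡ just x → last xs ≡ just y → f x ≡ f y
        go [-] refl refl = refl
        go (a ∷ ls) refl q = trans (adj a) (go ls refl q)

      -- The colouring marks the component of a after deletion of (a , b). If b were in it, a simple
      -- walk from a to b over other edges, closed by (a , b), would be a semicycle; a walk of one
      -- edge, which would make it too short, is excluded by the deletion and by antisymmetry.
      bridges : ∀ {x y} → x ⟶ y → Bridge _⟶_ x y
      bridges {a} {b} r = bridge-by f fa fb const
        where
        others = filter (λ e → ¬? (e ≟ᵉ (a , b))) (edges G)
        f : Vertex → Bool
        f v = does (rep others v ≟ rep others a)
        fa : f a ≡ true
        fa with rep others a ≟ rep others a
        ... | yes _ = refl
        ... | no ne = ⊥-elim (ne refl)
        other : ∀ {u v} → Joined others u v → Adjacent G u v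
        other (inj₁ m) = inj₁ (proj₁ (∈-filter⁻ (λ e → ¬? (e ≟ᵉ (a , b))) m))
        other (inj₂ m) = inj₂ (proj₁ (∈-filter⁻ (λ e → ¬? (e ≟ᵉ (a , b))) m))
        separated : ∀ {l} → ¬ Simple (Joined others) a b l
        separated stop = irreflexive G r
        separated (step (inj₁ m) _ stop) =
          proj₂ (∈-filter⁻ (λ e → ¬? (e ≟ᵉ (a , b))) {xs = edges G} m) refl
        separated (step (inj₂ m) _ stop) =
          antisymmetric D r (proj₁ (∈-filter⁻ (λ e → ¬? (e ≟ᵉ (a , b))) m))
        separated s@(step p _ t@(step _ _ u)) = asemicyclic _
          ( ( s≤s z≤n
            , nodes
            , simple-closed (weaken s) (inj₂ r))
          , s≤s (s≤s (bound u))
          , a , _ , refl , simple-unique s)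
          where
          weaken : ∀ {x y l} → Simple (Joined others) x y l → Simple (Adjacent G) x y l
          weaken stop = stop
          weaken (step p n s) = step (other p) n (weaken s)
          bound : ∀ {x y l} → Simple (Joined others) x y l → 2 ≤ length (l ∷ʳ a)
          bound stop = s≤s (s≤s z≤n)
          bound (step _ _ stop) = s≤s (s≤s z≤n)
          bound (step _ _ (step _ _ _)) = s≤s (s≤s z≤n)
          nodes = ∷ʳ⁺ (simple-all (λ p → adjacent-node (other p)) (proj₂ (endpoints G r)) s)
                      (proj₁ (endpoints G r))
        fb : f b ≡ false
        fb with rep others b ≟ rep others a
        ... | no _ = refl
        ... | yes eq = ⊥-elim (separated (proj₂ (loop-erase _≟_
          (rep-joined others a ◅◅ subst (λ v → Star (Joined others) v b) eq
            (Star.reverse joined-sym (rep-joined others b))))))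
        const : ∀ {u v} → u ⟶ v → f u ≡ f v ⊎ (u ≡ a × v ≡ b)
        const {u} {v} s with (u , v) ≟ᵉ (a , b)
        ... | yes refl = inj₂ (refl , refl)
        ... | no ne = inj₁ (cong (λ w → does (w ≟ rep others a))
          (rep-constant others (∈-filter⁺ (λ e → ¬? (e ≟ᵉ (a , b))) s ne)))

      decent : Decent _⟶_ nE nW
      decent Y {x} {y} {z} {w} t i j
        with paths-decent (trace t) ((path , trace-unique bridges (irreflexive G) t) , trace-linked t)
               (All.map inner⁻ (trace-inner t i j)) Y
        where
        path : IsChain G (trace t)
        path = nonempty′ , All.map (λ k → proj₁ (inner⁻ k)) (trace-inner t i j)
             , Linked.map inj₁ (trace-linked t)
          where
          nonempty′ : 1 ≤ length (trace t)
          nonempty′ with trace t | trace-head t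
          ... | _ | _ , refl = s≤s z≤n
      ... | inj₂ (inj₁ (_ , _ , _ , eq , k , p)) with trans (sym eq) (proj₂ (trace-head t))
      ...   | refl = inj₁ (cong proj₂ p)
      decent Y {x} {y} {z} {w} t i j | inj₂ (inj₂ (zs , _ , _ , eq , k , p))
        with last-two-injective zs _ (trans (sym eq) (proj₂ (trace-last t)))
      ...   | refl , refl = inj₂ (cong proj₁ p)
      decent Y {x} {y} {z} {w} t i j | inj₁ eq with trans (sym eq) (cong length (proj₂ (trace-head t)))
      ... | ()

      compassGraph : CompassGraph _⟶_ (Node D) nE nW
      compassGraph = record
        { halfE = halfE ; halfW = halfW ; decent = decent ; bridges = bridges
        ; connected = connected ; has-inner = proj₁ has-inner , inner⁺ (proj₂ has-inner) }

-- Basic K-graphs as relations.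

module Basics {ℓ : Level} {A : Set ℓ} where

  record Basic (R : A → A → Set ℓ) (In Out : A → Set ℓ) (b : A) : Set ℓ where
    field
      R⇒       : ∀ {x y} → R x y → (In x × y ≡ b) ⊎ (x ≡ b × Out y)
      in⇒      : ∀ {x} → In x → R x b
      out⇒     : ∀ {x} → Out x → R b x
      b∉in     : ¬ In b
      b∉out    : ¬ Out b
      apart    : ∀ {x} → In x → ¬ Out x
      some-in  : ∃ In
      some-out : ∃ Out

  private variable
    R : A → A → Set ℓ
    In Out : A → Set ℓ
    b : A

  basic-flip : Basic R In Out b → Basic (flip R) Out In b
  basic-flip B = record
    { R⇒ = λ r → swap⊎ (R⇒ r) ; in⇒ = out⇒ ; out⇒ = in⇒ ; b∉in = b∉out ; b∉out = b∉in
    ; apart = λ i j → apart j i ; some-in = some-out ; some-out = some-in }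
    where
    open Basic B
    swap⊎ : ∀ {P Q S T : Set ℓ} → (P × Q) ⊎ (S × T) → (T × S) ⊎ (Q × P)
    swap⊎ (inj₁ (p , q)) = inj₂ (q , p)
    swap⊎ (inj₂ (s , t)) = inj₁ (t , s)

  module BasicTheory (B : Basic R In Out b) where
    open Basic B

    inner-b : Inner R b
    inner-b = (_ , in⇒ (proj₂ some-in)) , (_ , out⇒ (proj₂ some-out))

    inner-unique : ∀ {x} → Inner R x → x ≡ b
    inner-unique ((_ , r) , (_ , s)) with R⇒ r | R⇒ s
    ... | inj₁ (_ , eq) | _             = eq
    ... | inj₂ (_ , o)  | inj₁ (i , _)  = ⊥-elim (apart i o)
    ... | inj₂ (_ , o)  | inj₂ (eq , _) = eq

    loopless : ¬ R b b
    loopless r with R⇒ r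
    ... | inj₁ (i , _) = b∉in i
    ... | inj₂ (_ , o) = b∉out o

    out-no-out : ∀ {x} → Out x → ¬ HasOut R x
    out-no-out o (_ , r) with R⇒ r
    ... | inj₁ (i , _)    = apart i o
    ... | inj₂ (refl , _) = b∉out o

    inner-walk : ∀ {x y z w} → Walk R x y z w → Inner R x → x ≡ b × y ≡ w
    inner-walk (one r) i = inner-unique i , refl
    inner-walk (r ◂ t) i with inner-unique i | inner-unique ((_ , r) , (_ , first t))
    ... | refl | refl = ⊥-elim (loopless r)

    -- No other edge touches x, so the colouring can single out x alone.
    basic-bridge : DecidableEquality A → ∀ {x} → In x → Bridge R x b
    basic-bridge _≟_ {x} i = bridge-by f fx fb const
      where
      f : A → Bool
      f v = does (v ≟ x)
      fx : f x ≡ true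
      fx with x ≟ x
      ... | yes _ = refl
      ... | no ne = ⊥-elim (ne refl)
      fb : f b ≡ false
      fb with b ≟ x
      ... | yes refl = ⊥-elim (b∉in i)
      ... | no _ = refl
      const : ∀ {u v} → R u v → f u ≡ f v ⊎ (u ≡ x × v ≡ b)
      const {u} {v} r with u ≟ x | v ≟ x | R⇒ r
      ... | no _     | no _     | _               = inj₁ refl
      ... | yes p    | _        | inj₁ (_ , q)    = inj₂ (p , q)
      ... | _        | yes refl | inj₁ (_ , refl) = ⊥-elim (b∉in i)
      ... | yes refl | _        | inj₂ (refl , _) = ⊥-elim (b∉in i)
      ... | _        | yes refl | inj₂ (_ , o)    = ⊥-elim (apart i o)

    module _ (n : Pole → A) (n-out : ∀ Y → Out (n Y)) where

      basic-half : (n N ≡ n S → ∀ {y} → Out y → y ≡ n N) → Half R (λ Y _ → n Y)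
      basic-half sep = record
        { points = λ Y i → subst (λ x → R x (n Y)) (sym (inner-unique i)) (out⇒ (n-out Y))
        ; functional = fun
        ; separates = sep′ }
        where
        fun : ∀ {x x′ y} → R x y → R x′ y → x′ ≡ x ⊎ HasOut R y
        fun r r′ with R⇒ r | R⇒ r′
        ... | inj₁ (_ , refl) | _               = inj₂ (proj₂ inner-b)
        ... | _               | inj₁ (_ , refl) = inj₂ (proj₂ inner-b)
        ... | inj₂ (p , _)    | inj₂ (q , _)    = inj₁ (trans q (sym p))
        sep′ : ∀ {x y} → Inner R x → n N ≡ n S → R x y → y ≡ n N
        sep′ i eq r with inner-unique i
        ... | refl with R⇒ r
        ...   | inj₁ (i , _) = ⊥-elim (b∉in i)
        ...   | inj₂ (_ , o) = sep eq o

      basic-distinguished : ∀ Y → Distinguished R (λ Y _ → n Y) Y b (n Y)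
      basic-distinguished Y = record
        { edge = out⇒ (n-out Y) ; no-out = out-no-out (n-out Y)
        ; good = λ t i → sym (proj₂ (inner-walk t i)) }

    -- Any other edge leaving b, taken as a walk of length one from the inner vertex b, is its own
    -- witness of badness.
    basic-only-good : DecidableEquality A → (n : Pole → A → A) → ∀ Y → OnlyGood R n Y b (n Y b)
    basic-only-good _≟_ n Y {x} {y} r ¬o with R⇒ r
    ... | inj₁ (_ , refl) = ⊥-elim (¬o (proj₂ inner-b))
    ... | inj₂ (refl , _) with y ≟ n Y b
    ...   | yes eq = inj₁ (refl , eq)
    ...   | no ne  = inj₂ (_ , _ , one r , inner-b , ≢-sym ne)

open Basics

-- From constructions to local compass graphs.

module Globals {ℓ : Level} (𝒰 : VertexUniverse ℓ) where
  open KGraphs 𝒰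
  open Graphs 𝒰
  open Cutting _≟_
  open IsCut

  -- `IsCut` removes just the edge (a , b) from the W piece, whereas `Cut` removes every edge ending
  -- in b; functionality makes this the same, and dually at c.
  cut-relational : ∀ {DW DE D a b c d} →
    Disjoint (vertices (digraph DW)) (vertices (digraph DE)) →
    IsFunctionalEEdge (digraph DW) (a , b) → IsFunctionalWEdge (digraph DE) (c , d) →
    IsCut DW (a , b) DE (c , d) D → HasIn (Arc DW) a → HasOut (Arc DE) d →
    Cut (Arc D) (Arc DW) (Arc DE) (Node D) (Node DW) (Node DE) a b c d
  cut-relational {DW} {DE} {D} {a} {b} {c} {d} disj
    ((eW , _ , noW) , funW) ((eE , _ , noE) , funE) K inA outD = record
    { VW? = λ x → x ∈? vertices (digraph DW) ; VE? = λ x → x ∈? vertices (digraph DE)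
    ; disjoint = λ i j → disj (i , j)
    ; endsW = endpoints (digraph DW) ; endsE = endpoints (digraph DE)
    ; eW = eW ; eE = eE
    ; no-out-b = noW _ ; no-in-c = noE _ ; only-b = funW _ ; only-c = funE _
    ; in-a = inA ; out-d = outD
    ; R⇒ = R⇒
    ; W⇒R = λ r y≢b → Equivalence.from (edges-cut K _) (inj₁ (r , λ eq → y≢b (cong proj₂ eq)))
    ; E⇒R = λ r x≢c → Equivalence.from (edges-cut K _) (inj₂ (inj₁ (r , λ eq → x≢c (cong proj₁ eq))))
    ; e = Equivalence.from (edges-cut K _) (inj₂ (inj₂ refl))
    ; V⇒ = V⇒
    ; W⇒V = λ i x≢b → Equivalence.from (vertices-cut K _)
        (inj₁ i , x≢b , λ { refl → disj (i , proj₁ (endpoints (digraph DE) eE)) })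
    ; E⇒V = λ i x≢c → Equivalence.from (vertices-cut K _)
        (inj₂ i , (λ { refl → disj (proj₂ (endpoints (digraph DW) eW) , i) }) , x≢c)
    }
    where
    open DecMembership _≟_ using (_∈?_)
    R⇒ : ∀ {x y} → Arc D x y →
         (Arc DW x y × y ≢ b) ⊎ (Arc DE x y × x ≢ c) ⊎ (x ≡ a × y ≡ d)
    R⇒ r with Equivalence.to (edges-cut K _) r
    ... | inj₁ (m , ne)        = inj₁ (m , λ { refl → ne (cong (_, b) (funW _ m)) })
    ... | inj₂ (inj₁ (m , ne)) = inj₂ (inj₁ (m , λ { refl → ne (cong (c ,_) (funE _ m)) }))
    ... | inj₂ (inj₂ refl)     = inj₂ (inj₂ (refl , refl))
    V⇒ : ∀ {x} → Node D x → (Node DW x × x ≢ b) ⊎ (Node DE x × x ≢ c)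
    V⇒ m with Equivalence.to (vertices-cut K _) m
    ... | inj₁ i , n , _ = inj₁ (i , n)
    ... | inj₂ i , _ , n = inj₂ (i , n)

  -- `link` serves the converse direction, where it prolongs a bad walk from the cut edge to the
  -- edge YE of the E piece. `walks` keeps explicit connections, from which the semipaths of the
  -- definition are extracted.
  record GlobalCompass (D : OrientedGraph) (κ : Compass) : Set ℓ where
    field
      nE nW : Pole → Vertex → Vertex
      graph : CompassGraph (Arc D) (Node D) nE nW
      walks : ∀ {x y} → Node D x → Node D y → Star (Adjacent (digraph D)) x y
      distE : ∀ Y → Distinguished (Arc D) nE Y (proj₁ (κ Y E)) (proj₂ (κ Y E))
      distW : ∀ Y → Distinguished (flip (Arc D)) nW Y (proj₂ (κ Y W)) (proj₁ (κ Y W))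
      link  : ∀ Y → Walk (Arc D) (proj₁ (κ Y W)) (proj₂ (κ Y W)) (proj₁ (κ Y E)) (proj₂ (κ Y E))

  open GlobalCompass

  adjacent-sym : ∀ {D x y} → Adjacent (digraph D) x y → Adjacent (digraph D) y x
  adjacent-sym (inj₁ r) = inj₂ r
  adjacent-sym (inj₂ r) = inj₁ r

  walks-constant : ∀ {D} →
    (∀ {x y} → Node D x → Node D y → Star (Adjacent (digraph D)) x y) →
    Connected (Arc D) (Node D)
  walks-constant {D} ws f k i j =
    Star.fold (λ x y → f x ≡ f y) (λ p eq → trans (adj p) eq) refl (ws i j)
    where
    adj : ∀ {x y} → Adjacent (digraph D) x y → f x ≡ f y
    adj (inj₁ r) = k r
    adj (inj₂ r) = sym (k r)

  basic-compass : ∀ {D κ} → IsBasicKGraph D κ → GlobalCompass D κ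
  basic-compass {D} {κ} isB = record
    { nE = λ Y _ → proj₂ (κ Y E) ; nW = λ Y _ → proj₁ (κ Y W)
    ; graph = record
      { halfE = B.basic-half (λ Y → proj₂ (κ Y E)) outE
          (λ eq o → short-constant
            (λ 2≤ → separateE 2≤ (cong₂ _,_ (trans (sourceE N) (sym (sourceE S))) eq))
            o (outE N))
      ; halfW = B′.basic-half (λ Y → proj₁ (κ Y W)) inW
          (λ eq o → short-constant
            (λ 2≤ → separateW 2≤ (cong₂ _,_ eq (trans (targetW N) (sym (targetW S)))))
            o (inW N))
      ; decent = dec
      ; bridges = br
      ; connected = walks-constant {D} ws
      ; has-inner = b , B.inner-b }
    ; walks = ws
    ; distE = dE ; distW = dW
    ; link = λ Y → subst₂ (λ y z → Walk (Arc D) (proj₁ (κ Y W)) y z (proj₂ (κ Y E)))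
        (sym (targetW Y)) (sym (sourceE Y)) (in⇒ (inW Y) ◂ one (out⇒ (outE Y)))
    }
    where
    open IsBasicKGraph isB
    R⇒ : ∀ {x y} → Arc D x y → (x ∈ as × y ≡ b) ⊎ (x ≡ b × y ∈ cs)
    R⇒ {x} {y} = Equivalence.to (edges-B x y)
    in⇒ : ∀ {x} → x ∈ as → Arc D x b
    in⇒ m = Equivalence.from (edges-B _ _) (inj₁ (m , refl))
    out⇒ : ∀ {x} → x ∈ cs → Arc D b x
    out⇒ m = Equivalence.from (edges-B _ _) (inj₂ (refl , m))
    some : ∀ {l : List Vertex} → 1 ≤ length l → ∃[ x ] x ∈ l
    some {x ∷ _} _ = x , here refl
    B-basic : Basic (Arc D) (_∈ as) (_∈ cs) b
    B-basic = record
      { R⇒ = R⇒ ; in⇒ = in⇒ ; out⇒ = out⇒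
      ; b∉in = λ m → irreflexive (digraph D) (in⇒ m)
      ; b∉out = λ m → irreflexive (digraph D) (out⇒ m)
      ; apart = λ i o → antisymmetric D (in⇒ i) (out⇒ o)
      ; some-in = some 1≤kW ; some-out = some 1≤kE }
    module B = BasicTheory B-basic
    module B′ = BasicTheory (basic-flip B-basic)
    κE : ∀ Y → proj₁ (κ Y E) ≡ b × proj₂ (κ Y E) ∈ cs
    κE Y with E-edges Y
    ... | r , _ , none with R⇒ r
    ...   | inj₂ p = p
    ...   | inj₁ (_ , eq) = let c , m = some 1≤kE in
      ⊥-elim (none c (subst (λ v → Arc D v c) (sym eq) (out⇒ m)))
    κW : ∀ Y → proj₁ (κ Y W) ∈ as × proj₂ (κ Y W) ≡ b
    κW Y with W-edges Y
    ... | r , _ , none with R⇒ r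
    ...   | inj₁ p = p
    ...   | inj₂ (eq , _) = ⊥-elim (none _ (subst (Arc D _) (sym eq) (in⇒ (proj₂ (some 1≤kW)))))
    sourceE = λ Y → proj₁ (κE Y)
    outE = λ Y → proj₂ (κE Y)
    inW = λ Y → proj₁ (κW Y)
    targetW = λ Y → proj₂ (κW Y)
    dec : Decent (Arc D) (λ Y _ → proj₂ (κ Y E)) (λ Y _ → proj₁ (κ Y W))
    -- Since b is the only inner vertex, a walk between inner vertices would be a loop at b.
    dec Y t i j with B.inner-walk t i | B.inner-unique j
    ... | refl , refl | refl = ⊥-elim (irreflexive (digraph D) (first t))
    br : ∀ {x y} → Arc D x y → Bridge (Arc D) x y
    br r with R⇒ r
    ... | inj₁ (i , refl) = B.basic-bridge _≟_ i
    ... | inj₂ (refl , o) = bridge-flip (B′.basic-bridge _≟_ o)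
    to-b : ∀ {x} → Node D x → Star (Adjacent (digraph D)) x b
    to-b {x} m = go as cs in⇒ out⇒ (Equivalence.to (vertices-B x) m)
      where
      go : ∀ us vs → (∀ {x} → x ∈ us → Arc D x b) → (∀ {x} → x ∈ vs → Arc D b x) →
           ∀ {x} → x ∈ us ++ b ∷ vs → Star (Adjacent (digraph D)) x b
      go [] vs p q (here refl) = ε
      go [] vs p q (there m) = inj₂ (q m) ◅ ε
      go (u ∷ us) vs p q (here refl) = inj₁ (p (here refl)) ◅ ε
      go (u ∷ us) vs p q (there m) = go us vs (p ∘ there) q m
    ws : ∀ {x y} → Node D x → Node D y → Star (Adjacent (digraph D)) x y
    ws i j = to-b i ◅◅ Star.reverse (adjacent-sym {D}) (to-b j)
    dE : ∀ Y → Distinguished (Arc D) (λ Y _ → proj₂ (κ Y E)) Y (proj₁ (κ Y E)) (proj₂ (κ Y E))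
    dE Y = subst (λ v → Distinguished (Arc D) _ Y v _) (sym (sourceE Y))
             (B.basic-distinguished (λ Y → proj₂ (κ Y E)) outE Y)
    dW : ∀ Y → Distinguished (flip (Arc D)) (λ Y _ → proj₁ (κ Y W)) Y (proj₂ (κ Y W)) (proj₁ (κ Y W))
    dW Y = subst (λ v → Distinguished (flip (Arc D)) _ Y v _) (sym (targetW Y))
             (B′.basic-distinguished (λ Y → proj₁ (κ Y W)) inW Y)

  cut-compass : ∀ {DW DE D κW κE eW eE} →
    GlobalCompass DW κW → GlobalCompass DE κE →
    Disjoint (vertices (digraph DW)) (vertices (digraph DE)) →
    IsFunctionalEEdge (digraph DW) eW → IsFunctionalWEdge (digraph DE) eE →
    (∀ Y → eW ≡ κW Y E ⊎ eE ≡ κE Y W) → IsCut DW eW DE eE D →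
    GlobalCompass D (cutCompass κW eW κE eE)
  cut-compass {DW} {DE} {D} {κW} {κE} {eW@(a , b)} {eE@(c , d)} GW GE disj fW fE match K = record
    { nE = join (nE GW) (nE GE) ; nW = join (nW GW) (nW GE)
    ; graph = record
      { halfE = T.half-glue (joinW (nE GW) (nE GE)) (joinE (nE GW) (nE GE))
          (halfE (graph GW)) (halfE (graph GE))
      ; halfW = T′.half-glue (joinE′ (nW GW) (nW GE)) (joinW′ (nW GW) (nW GE))
          (halfW (graph GE)) (halfW (graph GW))
      ; decent = T.decent-glue (joinW (nE GW) (nE GE)) (joinE (nE GW) (nE GE))
          (joinW (nW GW) (nW GE)) (joinE (nW GW) (nW GE))
          (decent (graph GW)) (decent (graph GE)) good
      ; bridges = T.bridges-glue (bridges (graph GW)) (bridges (graph GE))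
      ; connected = walks-constant {D} ws
      ; has-inner = _ , Γ.inner-homW Γ.inner-a }
    ; walks = ws
    ; distE = dE ; distW = dW ; link = lk
    }
    where
    open CompassGraph
    -- The definition of a cut does not state that a and d are inner. Otherwise the cut edge alone
    -- would be a whole piece, without inner vertices.
    inA : HasIn (Arc DW) a
    inA = source-hasIn _≟_ (graph GW) (endpoints (digraph DW)) (hasIn? DW a)
            (proj₁ (proj₁ fW)) (λ (u , r) → proj₂ (proj₂ (proj₁ fW)) u r)
    outD : HasOut (Arc DE) d
    outD = source-hasIn _≟_ (compassGraph-flip (graph GE)) (λ r → swap (endpoints (digraph DE) r))
            (hasOut? DE d) (proj₁ (proj₁ fE)) (λ (u , r) → proj₂ (proj₂ (proj₁ fE)) u r)
    C : Cut (Arc D) (Arc DW) (Arc DE) (Node D) (Node DW) (Node DE) a b c d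
    C = cut-relational disj fW fE K inA outD
    module Γ = Gluing C
    open Γ using (module PW; module PE)
    module T = Transfer C
    module T′ = Transfer (cut-flip C)
    -- Each vertex follows the compass of its own piece; the embedding turns a choice of (a , b) or
    -- (c , d) into the new edge.
    join : (n m : Pole → Vertex → Vertex) → Pole → Vertex → Vertex
    join n m Y x = if does (Cut.VW? C x) then PW.π (n Y x) else PE.π (m Y x)
    join-in : ∀ n m Y {x} → Node DW x → join n m Y x ≡ PW.π (n Y x)
    join-in n m Y {x} i with Cut.VW? C x
    ... | yes _ = refl
    ... | no ¬i = ⊥-elim (¬i i)
    join-out : ∀ n m Y {x} → Node DE x → join n m Y x ≡ PE.π (m Y x)
    join-out n m Y {x} i with Cut.VW? C x
    ... | yes j = ⊥-elim (disj (j , i))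
    ... | no _ = refl
    joinW : ∀ n m Y {x} → Inner (Arc DW) x → join n m Y (PW.π x) ≡ PW.π (n Y x)
    joinW n m Y (_ , (_ , r)) = trans (cong (join n m Y) (PW.π-source r))
      (join-in n m Y (proj₁ (endpoints (digraph DW) r)))
    joinE : ∀ n m Y {x} → Inner (Arc DE) x → join n m Y (PE.π x) ≡ PE.π (m Y x)
    joinE n m Y ((_ , r) , _) = trans (cong (join n m Y) (PE.π-source r))
      (join-out n m Y (proj₂ (endpoints (digraph DE) r)))
    joinW′ : ∀ n m Y {x} → Inner (flip (Arc DW)) x → join n m Y (PW.π x) ≡ PW.π (n Y x)
    joinW′ n m Y i = joinW n m Y (swap i)
    joinE′ : ∀ n m Y {x} → Inner (flip (Arc DE)) x → join n m Y (PE.π x) ≡ PE.π (m Y x)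
    joinE′ n m Y i = joinE n m Y (swap i)
    good : ∀ Y → Good (Arc DW) (nE GW) Y a b ⊎ Good (flip (Arc DE)) (nW GE) Y d c
    good Y with match Y
    ... | inj₁ refl = inj₁ (Distinguished.good (distE GW Y))
    ... | inj₂ refl = inj₂ (Distinguished.good (distW GE Y))
    walkW : ∀ {x y} → Star (Adjacent (digraph DW)) x y → Star (Adjacent (digraph D)) (PW.π x) (PW.π y)
    walkW = Star.gmap PW.π λ { (inj₁ r) → inj₁ (PW.hom r) ; (inj₂ r) → inj₂ (PW.hom r) }
    walkE : ∀ {x y} → Star (Adjacent (digraph DE)) x y → Star (Adjacent (digraph D)) (PE.π x) (PE.π y)
    walkE = Star.gmap PE.π λ { (inj₁ r) → inj₁ (PE.hom r) ; (inj₂ r) → inj₂ (PE.hom r) }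
    to-a : ∀ {x} → Node D x → Star (Adjacent (digraph D)) x (PW.π a)
    to-a {x} i with Cut.V⇒ C i
    ... | inj₁ (j , x≢b) = subst (λ v → Star _ v _) (PW.π-≢ x≢b) (walkW (walks GW j PW.Va))
    ... | inj₂ (j , x≢c) = subst₂ (Star _) (PE.π-≢ x≢c) (sym Γ.πa≡πc)
      (walkE (walks GE j (proj₁ (endpoints (digraph DE) (proj₁ (proj₁ fE))))))
    ws : ∀ {x y} → Node D x → Node D y → Star (Adjacent (digraph D)) x y
    ws i j = to-a i ◅◅ Star.reverse (adjacent-sym {D}) (to-a j)
    κ = cutCompass κW eW κE eE
    E≢b : ∀ Y → eW ≢ κW Y E → proj₂ (κW Y E) ≢ b
    E≢b Y ne eq = ne (
      cong₂ _,_ (sym (proj₂ fW _ (subst (Arc DW _) eq (Distinguished.edge (distE GW Y))))) (sym eq))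
    W≢c : ∀ Y → eE ≢ κE Y W → proj₁ (κE Y W) ≢ c
    W≢c Y ne eq = ne (
      cong₂ _,_ (sym eq) (sym (proj₂ fE _ (subst (λ v → Arc DE v _) eq (Distinguished.edge (distW GE Y))))))
    dE : ∀ Y → Distinguished (Arc D) (join (nE GW) (nE GE)) Y (proj₁ (κ Y E)) (proj₂ (κ Y E))
    dE Y with eW ≟ᵉ κW Y E
    ... | yes refl = T.distinguishedE (joinW (nE GW) (nE GE)) (joinE (nE GW) (nE GE))
      (distE GW Y) (distE GE Y)
    ... | no ne = T.distinguishedW (joinW (nE GW) (nE GE)) (distE GW Y) (E≢b Y ne)
    dW : ∀ Y → Distinguished (flip (Arc D)) (join (nW GW) (nW GE)) Y (proj₂ (κ Y W)) (proj₁ (κ Y W))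
    dW Y with eE ≟ᵉ κE Y W
    ... | yes refl = T′.distinguishedE (joinE′ (nW GW) (nW GE)) (joinW′ (nW GW) (nW GE))
      (distW GE Y) (distW GW Y)
    ... | no ne = T′.distinguishedW (joinE′ (nW GW) (nW GE)) (distW GE Y) (W≢c Y ne)
    lk : ∀ Y → Walk (Arc D) (proj₁ (κ Y W)) (proj₂ (κ Y W)) (proj₁ (κ Y E)) (proj₂ (κ Y E))
    lk Y = lk′ (eE ≟ᵉ κE Y W) (eW ≟ᵉ κW Y E)
      where
      module DW = Distinguished (distW GW Y)
      module DE = Distinguished (distE GE Y)
      fix-start = T′.ending-fixE DW.edge DW.no-out
      fix-end = T.ending-fixE DE.edge DE.no-out
      lk′ : (p : Dec (eE ≡ κE Y W)) (q : Dec (eW ≡ κW Y E)) →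
            let s = if does p then κW Y W else κE Y W
                t = if does q then κE Y E else κW Y E
            in Walk (Arc D) (proj₁ s) (proj₂ s) (proj₁ t) (proj₂ t)
      lk′ (yes refl) (yes refl) = subst₂ (λ (x , y) (z , w) → Walk (Arc D) x y z w)
        (cong₂ _,_ (proj₂ fix-start) (proj₁ fix-start)) (cong₂ _,_ (proj₁ fix-end) (proj₂ fix-end))
        (T.walk-across (link GW Y) (link GE Y))
      lk′ (yes _) (no ne) = subst₂ (λ (x , y) (z , w) → Walk (Arc D) x y z w)
        (cong₂ _,_ (proj₂ fix-start) (proj₁ fix-start)) (cong₂ _,_ (proj₁ fix) (proj₂ fix))
        (map PW.π PW.hom (link GW Y))
        where fix = T.fixW (Distinguished.edge (distE GW Y)) (E≢b Y ne)
      lk′ (no ne) (yes _) = subst₂ (λ (x , y) (z , w) → Walk (Arc D) x y z w)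
        (cong₂ _,_ (proj₁ fix) (proj₂ fix)) (cong₂ _,_ (proj₁ fix-end) (proj₂ fix-end))
        (map PE.π PE.hom (link GE Y))
        where fix = T.fixE (Distinguished.edge (distW GE Y)) (W≢c Y ne)
      -- Here YW would lie in the E piece and YE in the W piece, and no walk leads from the former
      -- to the latter; the matching condition rules this out.
      lk′ (no ne) (no ne′) with match Y
      ... | inj₁ eq = ⊥-elim (ne′ eq)
      ... | inj₂ eq = ⊥-elim (ne eq)

  compass-of : ∀ {D κ} → Construction D κ → GlobalCompass D κ
  compass-of (basic B) = basic-compass B
  compass-of (cut CW CE disj fW fE match K) =
    cut-compass (compass-of CW) (compass-of CE) disj fW fE match K

  global⇒local : ∀ D → IsGlobalKGraph D → IsLocalKGraph D
  global⇒local D (_ , c) = ToLocal.isLocalKGraph D (graph G) (walks G)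
    where G = compass-of c

-- One side of a graph, closed off by a new vertex.

module Branches {ℓ : Level} (𝒰 : VertexUniverse ℓ) where
  open KGraphs 𝒰
  open Graphs 𝒰

  -- The part of D on the vertices satisfying P, with a new vertex u and a new
  -- edge (p , q) between u and that part.
  module Branch (D : OrientedGraph) {P : Vertex → Set} (P? : ∀ v → Dec (P v)) {u p q : Vertex}
                (u∉ : ¬ Node D u)
                (ends : (p ≡ u × Node D q × P q) ⊎ (q ≡ u × Node D p × P p)) where
    private
      G = digraph D
      Q? : ∀ (e : Edge) → Dec (P (proj₁ e) × P (proj₂ e))
      Q? e = P? (proj₁ e) ×-dec P? (proj₂ e)
      vs : List Vertex
      vs = u ∷ filter P? (vertices G)
      es : List Edge
      es = (p , q) ∷ filter Q? (edges G)

    one-new : (¬ Node D p × Node D q) ⊎ (¬ Node D q × Node D p)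
    one-new = Sum.map (λ (eq , m , _) → (λ n → u∉ (subst (Node D) eq n)) , m)
                      (λ (eq , m , _) → (λ n → u∉ (subst (Node D) eq n)) , m) ends

    no-arc : ¬ Arc D p q
    no-arc r =
      [ (λ (n , _) → n (proj₁ (endpoints G r))) , (λ (n , _) → n (proj₂ (endpoints G r))) ]′ one-new

    no-coarc : ¬ Arc D q p
    no-coarc r =
      [ (λ (n , _) → n (proj₂ (endpoints G r))) , (λ (n , _) → n (proj₁ (endpoints G r))) ]′ one-new

    p≢q : p ≢ q
    p≢q eq =
      [ (λ (n , m) → n (subst (Node D) (sym eq) m)) , (λ (n , m) → n (subst (Node D) eq m)) ]′ one-new

    node⁻ : ∀ {v} → v ∈ vs → v ≡ u ⊎ (Node D v × P v)
    node⁻ (here eq) = inj₁ eq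
    node⁻ (there m) = inj₂ (∈-filter⁻ P? {xs = vertices G} m)

    node⁺ : ∀ {v} → Node D v → P v → v ∈ vs
    node⁺ m h = there (∈-filter⁺ P? m h)

    arc⁻ : ∀ {x y} → (x , y) ∈ es → (x ≡ p × y ≡ q) ⊎ (Arc D x y × P x × P y)
    arc⁻ (here refl) = inj₁ (refl , refl)
    arc⁻ (there m) = inj₂ (∈-filter⁻ Q? {xs = edges G} m)

    arc⁺ : ∀ {x y} → Arc D x y → P x → P y → (x , y) ∈ es
    arc⁺ r h k = there (∈-filter⁺ Q? r (h , k))

    new-ends : p ∈ vs × q ∈ vs
    new-ends =
      [ (λ (eq , m , h) → here eq , node⁺ m h) , (λ (eq , m , h) → node⁺ m h , here eq) ]′ ends

    branch : OrientedGraph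
    branch = record
      { digraph = record
        { vertices = vs
        ; edges = es
        ; vertices-unique = ¬Any⇒All¬ _ (λ m → u∉ (proj₁ (∈-filter⁻ P? {xs = vertices G} m)))
                            ∷ Unique.filter⁺ P? (vertices-unique G)
        ; edges-unique = ¬Any⇒All¬ _ (λ m → no-arc (proj₁ (∈-filter⁻ Q? {xs = edges G} m)))
                         ∷ Unique.filter⁺ Q? (edges-unique G)
        ; nonempty = u , here refl
        ; endpoints = ends′
        ; irreflexive = irr
        }
      ; antisymmetric = anti
      }
      where
      ends′ : ∀ {x y} → (x , y) ∈ es → x ∈ vs × y ∈ vs
      ends′ m with arc⁻ m
      ... | inj₁ (refl , refl) = new-ends
      ... | inj₂ (r , h , k) = node⁺ (proj₁ (endpoints G r)) h , node⁺ (proj₂ (endpoints G r)) k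
      irr : ∀ {x} → (x , x) ∉ es
      irr m with arc⁻ m
      ... | inj₁ (refl , eq) = p≢q eq
      ... | inj₂ (r , _) = irreflexive G r
      anti : ∀ {x y} → (x , y) ∈ es → (y , x) ∉ es
      anti m m′ with arc⁻ m | arc⁻ m′
      ... | inj₁ (refl , refl) | inj₁ (eq , _) = p≢q (sym eq)
      ... | inj₁ (refl , refl) | inj₂ (r , _)  = no-coarc r
      ... | inj₂ (r , _) | inj₁ (refl , refl)  = no-coarc r
      ... | inj₂ (r , _) | inj₂ (r′ , _)       = antisymmetric D r r′

open Branches

-- From local compass graphs to constructions.

module Locals {ℓ : Level} (𝒰 : VertexUniverse ℓ) where
  open KGraphs 𝒰
  open Graphs 𝒰
  open Globals 𝒰
  open Cutting _≟_

  -- The last two fields speak of the given compass `nE`, `nW` and not of one read off from the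
  -- construction. They are what allows a cut edge to be recognised as a distinguished edge of the
  -- piece built by induction.
  record Realised (D : OrientedGraph) (nE nW : Pole → Vertex → Vertex) : Set ℓ where
    field
      κ            : Compass
      construction : Construction D κ
      onlyE        : ∀ Y → OnlyGood (Arc D) nE Y (proj₁ (κ Y E)) (proj₂ (κ Y E))
      onlyW        : ∀ Y → OnlyGood (flip (Arc D)) nW Y (proj₂ (κ Y W)) (proj₁ (κ Y W))

  module Recombine (DW DE D : OrientedGraph) {nE nW : Pole → Vertex → Vertex} {a b c d : Vertex}
                   (C : CompassGraph (Arc D) (Node D) nE nW)
                   (K : Cut (Arc D) (Arc DW) (Arc DE) (Node D) (Node DW) (Node DE) a b c d) where
    module Γ = Gluing K
    module T = Transfer K
    module T′ = Transfer (cut-flip K)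

    graphW : CompassGraph (Arc DW) (Node DW) (T.ρW nE) (T.ρW nW)
    graphW = T.compassGraph-pieceW C

    graphE : CompassGraph (Arc DE) (Node DE) (T.ρE nE) (T.ρE nW)
    graphE = compassGraph-flip (T′.compassGraph-pieceW (compassGraph-flip C))

    -- Behind the termination of the induction: d is inner in D, and its place in the W piece is
    -- taken by b, which is not inner.
    innerW : ∀ {x} → Inner (Arc DW) x → Inner (Arc D) x × x ≢ d
    innerW i@(_ , (_ , s)) = subst (Inner (Arc D)) (Γ.PW.π-source s) (Γ.inner-homW i) ,
      λ { refl → Γ.PW.¬Vd (proj₁ (endpoints (digraph DW) s)) }

    innerE : ∀ {x} → Inner (Arc DE) x → Inner (Arc D) x × x ≢ a
    innerE i@((_ , s) , _) = subst (Inner (Arc D)) (Γ.PE.π-source s) (Γ.inner-homE i) ,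
      λ { refl → Γ.PE.¬Vd (proj₂ (endpoints (digraph DE) s)) }

    realise-cut : Disjoint (vertices (digraph DW)) (vertices (digraph DE)) →
                  IsFunctionalEEdge (digraph DW) (a , b) →
                  IsFunctionalWEdge (digraph DE) (c , d) →
                  IsCut DW (a , b) DE (c , d) D →
                  Realised DW (T.ρW nE) (T.ρW nW) → Realised DE (T.ρE nE) (T.ρE nW) →
                  Realised D nE nW
    realise-cut disjoint functionalE functionalW isCut HW HE = record
      { κ = cutCompass HW.κ (a , b) HE.κ (c , d)
      ; construction = cut HW.construction HE.construction disjoint functionalE functionalW match isCut
      ; onlyE = onlyE ; onlyW = onlyW }
      where
      module HW = Realised HW
      module HE = Realised HE
      chooseW : ∀ Y → (a , b) ≡ HW.κ Y E ⊎ Bad (Arc DW) (T.ρW nE) Y a b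
      chooseW Y = Sum.map₁ (λ (p , q) → cong₂ _,_ p q) (HW.onlyE Y Γ.eW (λ (_ , s) → Γ.no-out-b s))
      chooseE : ∀ Y → (c , d) ≡ HE.κ Y W ⊎ Bad (flip (Arc DE)) (T.ρE nW) Y d c
      chooseE Y = Sum.map₁ (λ (p , q) → cong₂ _,_ q p) (HE.onlyW Y Γ.eE (λ (_ , s) → Γ.no-in-c s))
      match : ∀ Y → (a , b) ≡ HW.κ Y E ⊎ (c , d) ≡ HE.κ Y W
      match Y =
        [ inj₁ , (λ β → [ inj₂ , (λ γ → ⊥-elim (T.not-both-bad C β γ)) ]′ (chooseE Y)) ]′ (chooseW Y)
      κ = cutCompass HW.κ (a , b) HE.κ (c , d)
      linkW = GlobalCompass.link (compass-of HW.construction)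
      linkE = GlobalCompass.link (compass-of HE.construction)
      chosenE : ∀ Y (p : Dec ((a , b) ≡ HW.κ Y E)) →
        let e = if does p then HE.κ Y E else HW.κ Y E
        in OnlyGood (Arc D) nE Y (proj₁ e) (proj₂ e)
      chosenE Y (yes eq) = T.only-goodE nE Y
        (subst (λ e → OnlyGood (Arc DW) (T.ρW nE) Y (proj₁ e) (proj₂ e)) (sym eq) (HW.onlyE Y))
        (HE.onlyE Y)
      -- Since (a , b) is not YE of the W piece, it is bad, and (c , d) must be YW of the E piece;
      -- the link of that piece then leads from (c , d) to its YE.
      chosenE Y (no ne) = T.only-goodW nE Y ([ ⊥-elim ∘ ne , id ]′ (chooseW Y)) (HW.onlyE Y)
        (subst (λ e → Walk (Arc DE) (proj₁ e) (proj₂ e) (proj₁ (HE.κ Y E)) (proj₂ (HE.κ Y E)))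
          (sym ([ ⊥-elim ∘ ne , id ]′ (match Y))) (linkE Y))
        (HE.onlyE Y)
      chosenW : ∀ Y (p : Dec ((c , d) ≡ HE.κ Y W)) →
        let e = if does p then HW.κ Y W else HE.κ Y W
        in OnlyGood (flip (Arc D)) nW Y (proj₂ e) (proj₁ e)
      chosenW Y (yes eq) = T′.only-goodE nW Y
        (subst (λ e → OnlyGood (flip (Arc DE)) (T.ρE nW) Y (proj₂ e) (proj₁ e)) (sym eq) (HE.onlyW Y))
        (HW.onlyW Y)
      chosenW Y (no ne) = T′.only-goodW nW Y ([ ⊥-elim ∘ ne , id ]′ (chooseE Y)) (HE.onlyW Y)
        (subst (λ e → Walk (flip (Arc DW)) (proj₂ e) (proj₁ e) (proj₂ (HW.κ Y W)) (proj₁ (HW.κ Y W)))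
          (sym ([ id , ⊥-elim ∘ ne ]′ (match Y))) (reverse (linkW Y)))
        (HW.onlyW Y)
      onlyE : ∀ Y → OnlyGood (Arc D) nE Y (proj₁ (κ Y E)) (proj₂ (κ Y E))
      onlyE Y = chosenE Y ((a , b) ≟ᵉ HW.κ Y E)
      onlyW : ∀ Y → OnlyGood (flip (Arc D)) nW Y (proj₂ (κ Y W)) (proj₁ (κ Y W))
      onlyW Y = chosenW Y ((c , d) ≟ᵉ HE.κ Y W)

  module _ (D : OrientedGraph) {nE nW : Pole → Vertex → Vertex}
           (C : CompassGraph (Arc D) (Node D) nE nW) where
    open CompassGraph C
    private
      G = digraph D
      _⟶_ = Arc D

    -- When no edge joins two inner vertices, by functionality the neighbours of
    -- an inner vertex b have no other neighbours, so D is b with its neighbours.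
    realise-basic : (∀ {x y} → x ⟶ y → Inner _⟶_ x → ¬ Inner _⟶_ y) → Realised D nE nW
    realise-basic isolated = record
      { κ = κ
      ; construction = basic record
        { as = as ; b = b ; cs = cs
        ; 1≤kW = nonempty-list (proj₂ some-in) ; 1≤kE = nonempty-list (proj₂ some-out)
        ; distinct = Unique.++⁺ (Unique.filter⁺ in? (vertices-unique G))
            (¬Any⇒All¬ _ b∉out ∷ Unique.filter⁺ out? (vertices-unique G)) disj
        ; vertices-B = λ v → mk⇔ covered node
        ; edges-B = λ x y → mk⇔ R⇒ λ { (inj₁ (m , refl)) → in⇒ m ; (inj₂ (refl , m)) → out⇒ m }
        ; W-edges = λ Y → pointsW Y
            , (proj₁ (endpoints G (pointsW Y)) , λ u r → B′.out-no-out (in⁺ (pointsW Y)) (u , r))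
        ; E-edges = λ Y → pointsE Y
            , (proj₂ (endpoints G (pointsE Y)) , λ u r → B.out-no-out (out⁺ (pointsE Y)) (u , r))
        ; separateW = λ 2≤ eq → apart-lemma 2≤ (Unique.filter⁺ in? (vertices-unique G))
            (λ m → Half.separates halfW (swap inn) (cong proj₁ eq) (in⇒ m))
        ; separateE = λ 2≤ eq → apart-lemma 2≤ (Unique.filter⁺ out? (vertices-unique G))
            (λ m → Half.separates halfE inn (cong proj₂ eq) (out⇒ m))
        }
      ; onlyE = B.basic-only-good _≟_ nE
      ; onlyW = B′.basic-only-good _≟_ nW
      }
      where
      b = proj₁ has-inner
      inn = proj₂ has-inner
      in? = λ x → DecMembership._∈?_ _≟ᵉ_ (x , b) (edges G)
      out? = λ x → DecMembership._∈?_ _≟ᵉ_ (b , x) (edges G)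
      as = filter in? (vertices G)
      cs = filter out? (vertices G)
      κ : Compass
      κ Y W = nW Y b , b
      κ Y E = b , nE Y b
      in⇒ : ∀ {x} → x ∈ as → x ⟶ b
      in⇒ m = proj₂ (∈-filter⁻ in? {xs = vertices G} m)
      out⇒ : ∀ {x} → x ∈ cs → b ⟶ x
      out⇒ m = proj₂ (∈-filter⁻ out? {xs = vertices G} m)
      in⁺ : ∀ {x} → x ⟶ b → x ∈ as
      in⁺ r = ∈-filter⁺ in? (proj₁ (endpoints G r)) r
      out⁺ : ∀ {x} → b ⟶ x → x ∈ cs
      out⁺ r = ∈-filter⁺ out? (proj₂ (endpoints G r)) r
      pointsE : ∀ Y → b ⟶ nE Y b
      pointsE Y = Half.points halfE Y inn
      pointsW : ∀ Y → nW Y b ⟶ b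
      pointsW Y = Half.points halfW Y (swap inn)
      b∉out : b ∉ cs
      b∉out m = irreflexive G (out⇒ m)
      some-in : ∃ (_∈ as)
      some-in = _ , in⁺ (proj₂ (proj₁ inn))
      some-out : ∃ (_∈ cs)
      some-out = _ , out⁺ (proj₂ (proj₂ inn))
      disj : ∀ {v} → ¬ (v ∈ as × v ∈ b ∷ cs)
      disj (m , here refl) = irreflexive G (in⇒ m)
      disj (m , there m′) = antisymmetric D (in⇒ m) (out⇒ m′)
      nonempty-list : ∀ {x} {l : List Vertex} → x ∈ l → 1 ≤ length l
      nonempty-list (here _) = s≤s z≤n
      nonempty-list (there _) = s≤s z≤n
      apart-lemma : ∀ {l z} → 2 ≤ length l → Unique l → (∀ {x} → x ∈ l → x ≡ z) → ⊥
      apart-lemma 2≤ u k with two-distinct u 2≤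
      ... | _ , _ , m , m′ , ne = ne (trans (k m) (sym (k m′)))
      split-source : ∀ {x y} → x ∈ as ++ b ∷ cs → x ⟶ y → (x ∈ as × y ≡ b) ⊎ (x ≡ b × y ∈ cs)
      split-source m r with ∈-++⁻ as m
      ... | inj₂ (here refl) = inj₂ (refl , out⁺ r)
      ... | inj₂ (there m′) = ⊥-elim (isolated (out⇒ m′) inn ((_ , out⇒ m′) , (_ , r)))
      ... | inj₁ m′ with Half.functional halfW (in⇒ m′) r
      ...   | inj₁ eq = inj₁ (m′ , eq)
      ...   | inj₂ i = ⊥-elim (isolated (in⇒ m′) (i , (_ , r)) inn)
      split-target : ∀ {x y} → y ∈ as ++ b ∷ cs → x ⟶ y → (x ∈ as × y ≡ b) ⊎ (x ≡ b × y ∈ cs)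
      split-target m r with ∈-++⁻ as m
      ... | inj₂ (here refl) = inj₁ (in⁺ r , refl)
      ... | inj₁ m′ = ⊥-elim (isolated (in⇒ m′) ((_ , r) , (_ , in⇒ m′)) inn)
      ... | inj₂ (there m′) with Half.functional halfE (out⇒ m′) r
      ...   | inj₁ eq = inj₂ (eq , m′)
      ...   | inj₂ o = ⊥-elim (isolated (out⇒ m′) inn ((_ , r) , o))
      -- The colouring marking b and its neighbours is constant on edges, so connectedness puts
      -- every vertex of D among them.
      member : Vertex → Bool
      member v = does (DecMembership._∈?_ _≟_ v (as ++ b ∷ cs))
      ends-member : ∀ {x y} → (x ∈ as × y ≡ b) ⊎ (x ≡ b × y ∈ cs) →
                    x ∈ as ++ b ∷ cs × y ∈ as ++ b ∷ cs
      ends-member (inj₁ (m , refl)) = ∈-++⁺ˡ m , ∈-++⁺ʳ as (here refl)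
      ends-member (inj₂ (refl , m)) = ∈-++⁺ʳ as (here refl) , ∈-++⁺ʳ as (there m)
      member-constant : ∀ {x y} → x ⟶ y → member x ≡ member y
      member-constant {x} {y} r
        with DecMembership._∈?_ _≟_ x (as ++ b ∷ cs) | DecMembership._∈?_ _≟_ y (as ++ b ∷ cs)
      ... | yes _ | yes _ = refl
      ... | no _  | no _  = refl
      ... | yes m | no ¬m = ⊥-elim (¬m (proj₂ (ends-member (split-source m r))))
      ... | no ¬m | yes m = ⊥-elim (¬m (proj₁ (ends-member (split-target m r))))
      covered : ∀ {v} → Node D v → v ∈ as ++ b ∷ cs
      covered {v} m
        with DecMembership._∈?_ _≟_ v (as ++ b ∷ cs) | DecMembership._∈?_ _≟_ b (as ++ b ∷ cs)
           | connected member member-constant m (proj₁ (endpoints G (proj₂ (proj₂ inn))))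
      ... | yes m′ | _     | _  = m′
      ... | no _   | yes _ | ()
      ... | no _   | no ¬m | _  = ⊥-elim (¬m (∈-++⁺ʳ as (here refl)))
      node : ∀ {v} → v ∈ as ++ b ∷ cs → Node D v
      node m with ∈-++⁻ as m
      ... | inj₁ m′ = proj₁ (endpoints G (in⇒ m′))
      ... | inj₂ (here refl) = proj₁ (endpoints G (proj₂ (proj₂ inn)))
      ... | inj₂ (there m′) = proj₂ (endpoints G (out⇒ m′))
      R⇒ : ∀ {x y} → x ⟶ y → (x ∈ as × y ≡ b) ⊎ (x ≡ b × y ∈ cs)
      R⇒ r = split-source (covered (proj₁ (endpoints G r))) r
      B-basic : Basic _⟶_ (_∈ as) (_∈ cs) b
      B-basic = record
        { R⇒ = R⇒ ; in⇒ = in⇒ ; out⇒ = out⇒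
        ; b∉in = λ m → irreflexive G (in⇒ m) ; b∉out = b∉out
        ; apart = λ i o → antisymmetric D (in⇒ i) (out⇒ o)
        ; some-in = some-in ; some-out = some-out }
      module B = BasicTheory B-basic
      module B′ = BasicTheory (basic-flip B-basic)

    -- The colouring of the bridge (a , d) sorts the vertices: the side of a is closed off by a new
    -- E-vertex b, the side of d by a new W-vertex c. Taking c different from b as well keeps the
    -- pieces disjoint.
    module Split {a d : Vertex} (r : a ⟶ d) (ia : Inner _⟶_ a) (jd : Inner _⟶_ d) where
      open Bridge (bridges r) renaming (colour to f; source to fa; target to fd; constant to k)

      b c : Vertex
      b = proj₁ (fresh (vertices G))
      c = proj₁ (fresh (b ∷ vertices G))

      b∉ : ¬ Node D b
      b∉ = proj₂ (fresh (vertices G))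
      c∉ : ¬ Node D c
      c∉ m = proj₂ (fresh (b ∷ vertices G)) (there m)
      c≢b : c ≢ b
      c≢b eq = proj₂ (fresh (b ∷ vertices G)) (here eq)

      a∈ : Node D a
      a∈ = proj₁ (endpoints G r)
      d∈ : Node D d
      d∈ = proj₂ (endpoints G r)

      module BW = Branch 𝒰 D (λ v → f v ≟ᵇ true) {b} {a} {b} b∉ (inj₂ (refl , a∈ , fa))
      module BE = Branch 𝒰 D (λ v → f v ≟ᵇ false) {c} {c} {d} c∉ (inj₁ (refl , d∈ , fd))

      DW DE : OrientedGraph
      DW = BW.branch
      DE = BE.branch

      clash : ∀ {v} → f v ≡ true → f v ≡ false → ⊥
      clash p q with trans (sym p) q
      ... | ()

      arc-colour : ∀ {x y} → x ⟶ y →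
        (f x ≡ true × f y ≡ true) ⊎ (f x ≡ false × f y ≡ false) ⊎ (x ≡ a × y ≡ d)
      arc-colour {x} s with k s
      ... | inj₂ p = inj₂ (inj₂ p)
      ... | inj₁ eq with f x in fx
      ...   | true = inj₁ (refl , sym eq)
      ...   | false = inj₂ (inj₁ (refl , sym eq))

      disjoint : Disjoint (vertices (digraph DW)) (vertices (digraph DE))
      disjoint (m , m′) with BW.node⁻ m | BE.node⁻ m′
      ... | inj₁ refl    | inj₁ eq       = c≢b (sym eq)
      ... | inj₁ refl    | inj₂ (n , _)  = b∉ n
      ... | inj₂ (n , _) | inj₁ refl     = c∉ n
      ... | inj₂ (_ , p) | inj₂ (_ , q)  = clash p q

      functionalE : IsFunctionalEEdge (digraph DW) (a , b)
      functionalE = (here refl , (here refl , no-out)) , only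
        where
        no-out : ∀ x → ¬ Arc DW b x
        no-out x m with BW.arc⁻ m
        ... | inj₁ (eq , _) = BW.p≢q (sym eq)
        ... | inj₂ (s , _) = b∉ (proj₁ (endpoints G s))
        only : ∀ x → Arc DW x b → x ≡ a
        only x m with BW.arc⁻ m
        ... | inj₁ (eq , _) = eq
        ... | inj₂ (s , _) = ⊥-elim (b∉ (proj₂ (endpoints G s)))

      functionalW : IsFunctionalWEdge (digraph DE) (c , d)
      functionalW = (here refl , (here refl , no-in)) , only
        where
        no-in : ∀ x → ¬ Arc DE x c
        no-in x m with BE.arc⁻ m
        ... | inj₁ (_ , eq) = BE.p≢q eq
        ... | inj₂ (s , _) = c∉ (proj₂ (endpoints G s))
        only : ∀ x → Arc DE c x → x ≡ d
        only x m with BE.arc⁻ m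
        ... | inj₁ (_ , eq) = eq
        ... | inj₂ (s , _) = ⊥-elim (c∉ (proj₁ (endpoints G s)))

      isCut : IsCut DW (a , b) DE (c , d) D
      isCut = record { vertices-cut = λ v → mk⇔ v⇒ v⇐ ; edges-cut = λ e → mk⇔ e⇒ e⇐ }
        where
        v⇒ : ∀ {v} → Node D v → (Node DW v ⊎ Node DE v) × v ≢ b × v ≢ c
        v⇒ {v} m = side , (λ { refl → b∉ m }) , (λ { refl → c∉ m })
          where
          side : Node DW v ⊎ Node DE v
          side with f v in fv
          ... | true = inj₁ (BW.node⁺ m fv)
          ... | false = inj₂ (BE.node⁺ m fv)
        v⇐ : ∀ {v} → (Node DW v ⊎ Node DE v) × v ≢ b × v ≢ c → Node D v
        v⇐ (inj₁ m , v≢b , _) with BW.node⁻ m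
        ... | inj₁ eq = ⊥-elim (v≢b eq)
        ... | inj₂ (n , _) = n
        v⇐ (inj₂ m , _ , v≢c) with BE.node⁻ m
        ... | inj₁ eq = ⊥-elim (v≢c eq)
        ... | inj₂ (n , _) = n
        e⇒ : ∀ {e} → e ∈ edges G →
             (e ∈ edges (digraph DW) × e ≢ (a , b)) ⊎
             (e ∈ edges (digraph DE) × e ≢ (c , d)) ⊎ e ≡ (a , d)
        e⇒ s with arc-colour s
        ... | inj₁ (p , q) = inj₁ (BW.arc⁺ s p q , λ { refl → b∉ (proj₂ (endpoints G s)) })
        ... | inj₂ (inj₁ (p , q)) = inj₂ (inj₁ (BE.arc⁺ s p q , λ { refl → c∉ (proj₁ (endpoints G s)) }))
        ... | inj₂ (inj₂ (refl , refl)) = inj₂ (inj₂ refl)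
        e⇐ : ∀ {e} →
             (e ∈ edges (digraph DW) × e ≢ (a , b)) ⊎
             (e ∈ edges (digraph DE) × e ≢ (c , d)) ⊎ e ≡ (a , d) →
             e ∈ edges G
        e⇐ (inj₁ (m , ne)) with BW.arc⁻ m
        ... | inj₁ (refl , refl) = ⊥-elim (ne refl)
        ... | inj₂ (s , _) = s
        e⇐ (inj₂ (inj₁ (m , ne))) with BE.arc⁻ m
        ... | inj₁ (refl , refl) = ⊥-elim (ne refl)
        ... | inj₂ (s , _) = s
        e⇐ (inj₂ (inj₂ refl)) = r

      in-a : HasIn (Arc DW) a
      in-a with proj₁ ia
      ... | u , s with arc-colour s
      ...   | inj₁ (p , q) = u , BW.arc⁺ s p q
      ...   | inj₂ (inj₁ (_ , q)) = ⊥-elim (clash fa q)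
      ...   | inj₂ (inj₂ (_ , refl)) = ⊥-elim (irreflexive G r)

      out-d : HasOut (Arc DE) d
      out-d with proj₂ jd
      ... | u , s with arc-colour s
      ...   | inj₁ (p , _) = ⊥-elim (clash p fd)
      ...   | inj₂ (inj₁ (p , q)) = u , BE.arc⁺ s p q
      ...   | inj₂ (inj₂ (refl , _)) = ⊥-elim (irreflexive G r)

      K : Cut _⟶_ (Arc DW) (Arc DE) (Node D) (Node DW) (Node DE) a b c d
      K = cut-relational disjoint functionalE functionalW isCut in-a out-d

      open Recombine DW DE D C K public

  -- l lists a set containing the inner vertices; each piece of a cut loses one.
  realise : ∀ n D {nE nW} → CompassGraph (Arc D) (Node D) nE nW →
            (l : List Vertex) → length l < n → (∀ {x} → Inner (Arc D) x → x ∈ l) →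
            Realised D nE nW
  realise (suc n) D C l l<n bound
    with any? (λ e → inner? D (proj₁ e) ×-dec inner? D (proj₂ e)) (edges (digraph D))
  ... | no none = realise-basic D C (λ r i j → none (lose r (i , j)))
  ... | yes some with find some
  ...   | (a , d) , r , ia , jd = realise-cut disjoint functionalE functionalW isCut
    (realise n DW graphW (without d) (shrink jd)
      (λ i → let j , ne = innerW i in ∈-filter⁺ (≢? d) (bound j) ne))
    (realise n DE graphE (without a) (shrink ia)
      (λ i → let j , ne = innerE i in ∈-filter⁺ (≢? a) (bound j) ne))
    where
    open Split D C r ia jd
    ≢? : ∀ v x → Dec (x ≢ v)
    ≢? v x = ¬? (x ≟ v)
    without : Vertex → List Vertex
    without v = filter (≢? v) l
    shrink : ∀ {v} → Inner (Arc D) v → length (without v) < n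
    shrink {v} i = <-≤-trans (filter-notAll (≢? v) l (lose (bound i) (λ ne → ne refl))) (s≤s⁻¹ l<n)

  local⇒global : ∀ D → IsLocalKGraph D → IsGlobalKGraph D
  local⇒global D (𝓛 , L) = _ , Realised.construction
    (realise _ D (FromLocal.compassGraph D 𝓛 L) (vertices (digraph D)) ≤-refl
      (λ i → proj₁ (inner⁻ D i)))

mainTheorem3 : ∀ {ℓ} (𝒰 : VertexUniverse ℓ) (D : KGraphs.OrientedGraph 𝒰) →
    KGraphs.IsGlobalKGraph 𝒰 D ⇔ KGraphs.IsLocalKGraph 𝒰 D
mainTheorem3 𝒰 D = mk⇔ (Globals.global⇒local 𝒰 D) (Locals.local⇒global 𝒰 D)
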